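{- Let $n\ge2$, $k\ge3$, $\varepsilon>0$, and let $f:S_k^n\to[k]$ be a social choice function with $\mathbf{D}(f,\overline{\mathrm{NONMANIP}})\ge\varepsilon$. Let $\sigma\in S_k^n$ be uniformly random. Then $$\mathbb{P}(\sigma\in M(f))\ge\frac{\varepsilon^5}{4n^7k^{12}(k!)^4}.$$ Moreover, if $\sigma'$ is obtained from $\sigma$ by choosing a coordinate $i\in[n]$ uniformly at random and replacing $\sigma_i$ by an independent uniformly random ranking in $S_k$, then $$\mathbb{P}\big((\sigma,\sigma')\text{ is a manipulation pair for }f\big)\ge\frac{\varepsilon^5}{4n^8k^{12}(k!)^5}.$$
   Context: $[k]=\{1,\dots,k\}$, $S_k$ is the set of total orderings of $[k]$, a social choice function is a map $f:S_k^n\to[k]$. Write $a\overset{\sigma_i}{>}b$ if $\sigma_i$ ranks $a$ above $b$. $(\sigma,\sigma')$ is a manipulation pair for $f$ if $\sigma,\sigma'$ differ only in some coordinate $i$ and $f(\sigma')\overset{\sigma_i}{>}f(\sigma)$; $\sigma$ is then a manipulation point, and $M(f)$ is the set of manipulation points. $\overline{\mathrm{NONMANIP}}$ is the set of SCFs $f:S_k^n\to[k]$ that depend on only one coordinate or take at most two values. $\mathbf{D}(f,g)=\mathbb{P}(f(\sigma)\ne g(\sigma))$ for uniform $\sigma$, and $\mathbf{D}(f,G)=\min_{g\in G}\mathbf{D}(f,g)$. -}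

module Defs where

open import Data.Nat using (ℕ; _<_)
open import Data.Fin using (Fin)
open import Data.Fin.Properties using () renaming (_≟_ to _≟ᶠ_)
open import Data.Vec using (Vec; lookup; toList; _[_]≔_)
open import Data.List using (List; length)
open import Data.List.Relation.Unary.All using (All)
open import Data.List.Relation.Unary.Unique.Propositional using (Unique)
import Data.List.Relation.Unary.Unique.DecPropositional as DU
open import Data.Product using (Σ; Σ-syntax; ∃; ∃-syntax; _×_; _,_; proj₁)
open import Data.Sum using (_⊎_)
open import Relation.Nullary using (¬_)
open import Relation.Nullary.Decidable using (True)
open import Relation.Binary.PropositionalEquality using (_≡_; _≢_)

-- A ranking σ ∈ S_k, encoded by its rank vector: lookup v a is the position
-- of candidate a (0 = top).  The vector must be injective (a bijection
-- Fin k → Fin k).  `True` makes the validity witness proof-irrelevant, so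
-- Ranking k is in bijection with S_k and has decidable equality.
Ranking : ℕ → Set
Ranking k = Σ[ v ∈ Vec (Fin k) k ] True (DU.unique? _≟ᶠ_ (toList v))

rank : ∀ {k} → Ranking k → Fin k → Fin k
rank σ a = lookup (proj₁ σ) a

_≻[_]_ : ∀ {k} → Fin k → Ranking k → Fin k → Set
a ≻[ σ ] b = Data.Fin._<_ (rank σ a) (rank σ b)
  where import Data.Fin

Profile : ℕ → ℕ → Set
Profile n k = Vec (Ranking k) n

SCF : ℕ → ℕ → Set
SCF n k = Profile n k → Fin k

DifferOnlyAt : ∀ {n k} → Profile n k → Profile n k → Fin n → Set
DifferOnlyAt {n} σ σ' i = (j : Fin n) → j ≢ i → lookup σ j ≡ lookup σ' j

ManipPair : ∀ {n k} → SCF n k → Profile n k → Profile n k → Set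
ManipPair {n} f σ σ' =
  Σ[ i ∈ Fin n ] (DifferOnlyAt σ σ' i × (f σ' ≻[ lookup σ i ] f σ))

ManipPoint : ∀ {n k} → SCF n k → Profile n k → Set
ManipPoint {n} {k} f σ = Σ[ σ' ∈ Profile n k ] ManipPair f σ σ'

DependsOnOneCoord : ∀ {n k} → SCF n k → Set
DependsOnOneCoord {n} {k} g =
  Σ[ i ∈ Fin n ] ((σ σ' : Profile n k) → lookup σ i ≡ lookup σ' i → g σ ≡ g σ')

AtMostTwoValues : ∀ {n k} → SCF n k → Set
AtMostTwoValues {n} {k} g =
  Σ[ a ∈ Fin k ] Σ[ b ∈ Fin k ] ((σ : Profile n k) → (g σ ≡ a) ⊎ (g σ ≡ b))

NonManip : ∀ {n k} → SCF n k → Set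
NonManip g = DependsOnOneCoord g ⊎ AtMostTwoValues g

-- "#{x ∈ A : P x} ≥ num / den" for a finite type A: there is a duplicate-free
-- list of elements satisfying P whose length ℓ satisfies num ≤ den * ℓ.
CountAtLeast : {A : Set} → (A → Set) → ℕ → ℕ → Set
CountAtLeast {A} P num den =
  Σ[ xs ∈ List A ] (Unique xs × All P xs × num Data.Nat.≤ den Data.Nat.* length xs)
  where import Data.Nat

{-# OPTIONS --safe #-}
-- Fix two voters i ≠ j and the other votes.  If no profile of the resulting plane is manipulable,
-- the two-voter function on it is either of range at most two or independent of one voter.  Hence,
-- writing ∂ᵢ(a,b) for the profiles at which voter i alone can bring about a as well as b:
--  * off the bad planes, ∂ᵢ(a,b) is closed under changes of other votes that keep a versus b;
--  * ∂ᵢ(a,b) ∩ ∂ⱼ(c,d) lies in bad planes as soon as c ∉ {a,b}.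
-- A function far from NONMANIP has two such boundaries of measure λ ≥ ε/(nk³): isoperimetry around
-- the most popular outcome gives the first, isoperimetry around the pair of outcomes so found the
-- second, and if both belong to one voter, some other voter is influential as well.
-- By the first point each boundary is nearly a union of fibres of the {0,1}ⁿ-valued map recording
-- a versus b (respectively c versus d) for each voter.  The two maps have coordinatewise
-- correlation at most 1/3 in absolute value, so reverse hypercontractivity, used in the form
-- P(A ∩ B) ≥ P(A)² P(B)², makes the boundaries meet with probability λ⁴ up to a leak O(n) P(bad).
-- By the second point P(bad) ≥ λ⁴/(1 + 2n), while P(bad) ≤ (k!)² P(M).
module Submission where

open import Defs
open import Data.Nat
open import Data.Nat.Properties
open import Data.Nat.Tactic.RingSolver using (solve-∀)
open import Data.Bool as Bool using (Bool; true; false; not)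
open import Data.Bool.Properties as Boolₚ using (T-irrelevant; ¬-not)
open import Data.Empty using (⊥; ⊥-elim)
open import Data.Fin as F using (Fin; zero; suc; punchIn; punchOut; opposite)
open import Data.Fin.Permutation.Components using (transpose; transpose-inverse)
import Data.Fin.Properties as Fₚ
open import Data.List as List using (List; []; _∷_; _++_; length; filter; allFin; cartesianProductWith)
import Data.List.Properties as Listₚ
open import Data.List.Membership.Propositional using (_∈_; lose)
open import Data.List.Membership.Propositional.Properties
  using (∈-∃++; ∈-++⁻; ∈-++⁺ˡ; ∈-++⁺ʳ; ∈-allFin; ∈-cartesianProductWith⁺)
open import Data.List.Relation.Unary.All as All using (All; []; _∷_)
open import Data.List.Relation.Unary.All.Properties using (all-filter)
open import Data.List.Relation.Unary.AllPairs using ([]; _∷_)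
open import Data.List.Relation.Unary.Any as Any using (here; there; any?)
open import Data.List.Relation.Unary.Unique.Propositional using (Unique)
import Data.List.Relation.Unary.Unique.Propositional.Properties as Uniqueₚ
open import Data.Product using (Σ-syntax; ∃; _×_; _,_; proj₁; proj₂)
open import Data.Sum using (_⊎_; inj₁; inj₂)
open import Data.Unit using (tt)
open import Data.Vec as Vec using (Vec; []; _∷_; lookup; toList; tabulate; _[_]≔_)
import Data.Vec.Properties as Vecₚ
open import Function using (_∘_; flip; id)
open import Relation.Binary using (tri<; tri≈; tri>)
open import Relation.Binary.PropositionalEquality
open import Relation.Nullary
open import Relation.Nullary.Decidable
  using (toWitness; fromWitness; dec-true; dec-false; map′; decidable-stable)

-- On a plane without manipulation each voter receives the best outcome of a menu fixed by the other
-- vote, so the claims about planes become claims about how a menu reacts to the other vote. The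
-- squares in P(A)² P(B)² are those of the L^(1/2) norm (E √F)²: its reverse hypercontractive
-- inequality holds up to correlation 1/2, that is, as long as agreement of the two bits is at most
-- three times as frequent as disagreement and conversely. Comparisons of different pairs stay
-- within this range even if the pairs share a candidate, which cannot be excluded here: d may be a
-- or b. Stated for sums of functions whose squares appear on the other side, the inequality needs
-- no roots, and the whole proof can count in natural numbers. The leak is linear in n because two
-- profiles of one fibre are joined by changing one vote at a time. The intermediate profiles are
-- uniform as well, so each of the n steps enters the boundary with probability at most P(bad). The
-- same path, with unrestricted steps, yields both isoperimetric estimates and the influence of a
-- second voter.

private variable
  A B C : Set
  k m n : ℕ

-- Rankings

all-lookup : ∀ {A : Set} {P : A → Set} (v : Vec A m) →
  All P (toList v) → ∀ i → P (lookup v i)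
all-lookup (x ∷ v) (p ∷ ps) zero = p
all-lookup (x ∷ v) (p ∷ ps) (suc i) = all-lookup v ps i

all-tabulate : ∀ {A : Set} {P : A → Set} (v : Vec A m) →
  (∀ i → P (lookup v i)) → All P (toList v)
all-tabulate [] p = []
all-tabulate (x ∷ v) p = p zero ∷ all-tabulate v (p ∘ suc)

unique⇒injective : ∀ {A : Set} (v : Vec A m) → Unique (toList v) →
  ∀ {i j} → lookup v i ≡ lookup v j → i ≡ j
unique⇒injective (x ∷ v) (x∉ ∷ u) {zero} {zero} eq = refl
unique⇒injective (x ∷ v) (x∉ ∷ u) {zero} {suc j} eq = contradiction eq (all-lookup v x∉ j)
unique⇒injective (x ∷ v) (x∉ ∷ u) {suc i} {zero} eq = contradiction (sym eq) (all-lookup v x∉ i)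
unique⇒injective (x ∷ v) (x∉ ∷ u) {suc i} {suc j} eq = cong suc (unique⇒injective v u eq)

injective⇒unique : ∀ {A : Set} (v : Vec A m) →
  (∀ {i j} → lookup v i ≡ lookup v j → i ≡ j) → Unique (toList v)
injective⇒unique [] inj = []
injective⇒unique (x ∷ v) inj =
  all-tabulate v (λ j eq → case-0 (inj {zero} {suc j} eq))
    ∷ injective⇒unique v (Fₚ.suc-injective ∘ inj)
  where
  case-0 : ∀ {n} {j : Fin n} → Fin.zero ≢ suc j
  case-0 ()

fromVec : (v : Vec (Fin k) k) → (∀ {i j} → lookup v i ≡ lookup v j → i ≡ j) → Ranking k
fromVec v inj = v , fromWitness (injective⇒unique v inj)

fromInjection : (g : Fin k → Fin k) → (∀ {i j} → g i ≡ g j → i ≡ j) → Ranking k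
fromInjection g inj = fromVec (tabulate g)
  (λ {i} {j} eq → inj (trans (sym (Vecₚ.lookup∘tabulate g i)) (trans eq (Vecₚ.lookup∘tabulate g j))))

rank-fromInjection : (g : Fin k → Fin k) (inj : ∀ {i j} → g i ≡ g j → i ≡ j) (a : Fin k) →
  rank (fromInjection g inj) a ≡ g a
rank-fromInjection g inj a = Vecₚ.lookup∘tabulate g a

rank-injective : (σ : Ranking k) {a b : Fin k} → rank σ a ≡ rank σ b → a ≡ b
rank-injective (v , u) = unique⇒injective v (toWitness u)

ranking-≡ : {σ τ : Ranking k} → proj₁ σ ≡ proj₁ τ → σ ≡ τ
ranking-≡ {σ = v , p} {.v , q} refl = cong (v ,_) (T-irrelevant p q)

ranking-ext : {σ τ : Ranking k} → (∀ a → rank σ a ≡ rank τ a) → σ ≡ τ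
ranking-ext {σ = σ} {τ} eq = ranking-≡ (begin
  proj₁ σ                    ≡⟨ Vecₚ.tabulate∘lookup (proj₁ σ) ⟨
  tabulate (lookup (proj₁ σ)) ≡⟨ Vecₚ.tabulate-cong eq ⟩
  tabulate (lookup (proj₁ τ)) ≡⟨ Vecₚ.tabulate∘lookup (proj₁ τ) ⟩
  proj₁ τ                    ∎)
  where open ≡-Reasoning

-- ≻ unfolds to an inequality between lookups, from which unification cannot recover the ranking.
record _≫[_]_ (a : Fin k) (σ : Ranking k) (b : Fin k) : Set where
  constructor wrap
  field unwrap : a ≻[ σ ] b
open _≫[_]_

≫-asym : {a b : Fin k} {σ : Ranking k} → a ≫[ σ ] b → ¬ b ≫[ σ ] a
≫-asym (wrap a≻b) (wrap b≻a) = <-asym a≻b b≻a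

≫-total : (σ : Ranking k) {a b : Fin k} → a ≢ b → a ≫[ σ ] b ⊎ b ≫[ σ ] a
≫-total σ {a} {b} a≢b with Fₚ.<-cmp (rank σ a) (rank σ b)
... | tri< a<b _ _ = inj₁ (wrap a<b)
... | tri≈ _ eq _  = contradiction (rank-injective σ eq) a≢b
... | tri> _ _ b<a = inj₂ (wrap b<a)

-- Inserts a new candidate at rank `x` and keeps the order of the others. Together with its inverse
-- `restrict` it makes a ranking of `suc k` candidates a pair, whence the factorial count.
extend : Fin (suc k) → Ranking k → Ranking (suc k)
extend x τ = fromVec (x ∷ Vec.map (punchIn x) (proj₁ τ)) (λ {i} {j} → inj i j)
  where
  inj : ∀ i j → lookup (x ∷ Vec.map (punchIn x) (proj₁ τ)) i
              ≡ lookup (x ∷ Vec.map (punchIn x) (proj₁ τ)) j → i ≡ j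
  inj zero zero eq = refl
  inj zero (suc j) eq = contradiction (trans (sym (Vecₚ.lookup-map j (punchIn x) (proj₁ τ))) (sym eq)) (Fₚ.punchInᵢ≢i x _)
  inj (suc i) zero eq = contradiction (trans (sym (Vecₚ.lookup-map i (punchIn x) (proj₁ τ))) eq) (Fₚ.punchInᵢ≢i x _)
  inj (suc i) (suc j) eq = cong suc (rank-injective τ (Fₚ.punchIn-injective x _ _
    (trans (sym (Vecₚ.lookup-map i (punchIn x) (proj₁ τ))) (trans eq (Vecₚ.lookup-map j (punchIn x) (proj₁ τ))))))

rankings : ∀ k → List (Ranking k)
rankings zero    = ([] , tt) ∷ []
rankings (suc k) = cartesianProductWith extend (allFin (suc k)) (rankings k)

extend-injective : {x y : Fin (suc k)} {σ τ : Ranking k} →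
  extend x σ ≡ extend y τ → x ≡ y × σ ≡ τ
extend-injective {x = x} {y} {σ} {τ} eq
  with refl ← Vecₚ.∷-injectiveˡ (cong proj₁ eq) = refl , ranking-ext λ a →
  Fₚ.punchIn-injective x _ _ (trans (sym (Vecₚ.lookup-map a (punchIn x) (proj₁ σ)))
    (trans (cong (λ v → lookup v a) (Vecₚ.∷-injectiveʳ (cong proj₁ eq)))
           (Vecₚ.lookup-map a (punchIn x) (proj₁ τ))))

rankings-unique : ∀ k → Unique (rankings k)
rankings-unique zero    = [] ∷ []
rankings-unique (suc k) = Uniqueₚ.cartesianProductWith⁺ extend extend-injective
  (Uniqueₚ.allFin⁺ (suc k)) (rankings-unique k)

restrict : (σ : Ranking (suc k)) → Σ[ τ ∈ Ranking k ] extend (rank σ zero) τ ≡ σ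
restrict {k} σ = τ , ranking-ext pointwise
  where
  0≢ : ∀ a → rank σ zero ≢ rank σ (suc a)
  0≢ a eq with () ← rank-injective σ eq
  punched-injective : ∀ {a b} → punchOut (0≢ a) ≡ punchOut (0≢ b) → a ≡ b
  punched-injective eq = Fₚ.suc-injective (rank-injective σ (Fₚ.punchOut-injective (0≢ _) (0≢ _) eq))
  τ : Ranking k
  τ = fromInjection (λ a → punchOut (0≢ a)) punched-injective
  pointwise : ∀ a → rank (extend (rank σ zero) τ) a ≡ rank σ a
  pointwise zero = refl
  pointwise (suc a) = trans (Vecₚ.lookup-map a _ (proj₁ τ))
    (trans (cong (punchIn (rank σ zero)) (rank-fromInjection _ punched-injective a)) (Fₚ.punchIn-punchOut (0≢ a)))

∈-rankings : (σ : Ranking k) → σ ∈ rankings k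
∈-rankings {zero}  ([] , tt) = here refl
∈-rankings {suc k} σ with restrict σ
... | τ , eq = subst (_∈ rankings (suc k)) eq
  (∈-cartesianProductWith⁺ extend (∈-allFin (rank σ zero)) (∈-rankings τ))

-- Moving a candidate to the top

raise : Fin k → Fin k → Fin k
raise {suc k} p q with p F.≟ q
... | yes _  = zero
... | no p≢q = suc (punchOut p≢q)

raise-top : (p q : Fin k) → p ≢ q → raise p p F.< raise p q
raise-top {suc k} p q p≢q with p F.≟ p | p F.≟ q
... | no p≢p | _       = contradiction refl p≢p
... | yes _  | yes p≡q = contradiction p≡q p≢q
... | yes _  | no _    = z<s

raise-mono-< : {p q r : Fin k} → p ≢ q → p ≢ r → q F.< r → raise p q F.< raise p r
raise-mono-< {suc k} {p} {q} {r} p≢q p≢r q<r with p F.≟ q | p F.≟ r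
... | yes p≡q | _       = contradiction p≡q p≢q
... | no _    | yes p≡r = contradiction p≡r p≢r
... | no ≢q   | no ≢r   = s<s (≰⇒> λ r≤q → <⇒≱ q<r (Fₚ.punchOut-cancel-≤ ≢r ≢q r≤q))

raise-injective : (p : Fin k) {q r : Fin k} → raise p q ≡ raise p r → q ≡ r
raise-injective p {q} {r} eq with Fₚ.<-cmp q r | p F.≟ q | p F.≟ r
... | tri≈ _ q≡r _ | _        | _        = q≡r
... | tri< q<r q≢r _ | yes refl | _      = contradiction eq (Fₚ.<⇒≢ (raise-top p r q≢r))
... | tri> _ q≢r _ | yes refl | _        = contradiction eq (Fₚ.<⇒≢ (raise-top p r q≢r))
... | tri< _ q≢r _ | no _     | yes refl = contradiction (sym eq) (Fₚ.<⇒≢ (raise-top p q (q≢r ∘ sym)))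
... | tri> _ q≢r _ | no _     | yes refl = contradiction (sym eq) (Fₚ.<⇒≢ (raise-top p q (q≢r ∘ sym)))
... | tri< q<r _ _ | no p≢q   | no p≢r   = contradiction eq (Fₚ.<⇒≢ (raise-mono-< p≢q p≢r q<r))
... | tri> _ _ r<q | no p≢q   | no p≢r   = contradiction (sym eq) (Fₚ.<⇒≢ (raise-mono-< p≢r p≢q r<q))

abstract
  -- After the abstract block only `up-top` and `up-mono` are used of it: the candidate comes first
  -- and the order of the others is kept.
  up : Fin k → Ranking k → Ranking k
  up a σ = fromInjection (raise (rank σ a) ∘ rank σ) (rank-injective σ ∘ raise-injective (rank σ a))

  rank-up : (a : Fin k) (σ : Ranking k) (b : Fin k) → rank (up a σ) b ≡ raise (rank σ a) (rank σ b)
  rank-up a σ b = rank-fromInjection _ (rank-injective σ ∘ raise-injective (rank σ a)) b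

  up-top : (a : Fin k) (σ : Ranking k) {b : Fin k} → b ≢ a → a ≫[ up a σ ] b
  up-top a σ {b} b≢a = wrap (subst₂ F._<_ (sym (rank-up a σ a)) (sym (rank-up a σ b))
    (raise-top (rank σ a) (rank σ b) (b≢a ∘ sym ∘ rank-injective σ)))

  up-mono : (a : Fin k) (σ : Ranking k) {b c : Fin k} → b ≢ a → c ≢ a →
    b ≫[ σ ] c → b ≫[ up a σ ] c
  up-mono a σ {b} {c} b≢a c≢a (wrap b≻c) = wrap (subst₂ F._<_ (sym (rank-up a σ b)) (sym (rank-up a σ c))
    (raise-mono-< (b≢a ∘ sym ∘ rank-injective σ) (c≢a ∘ sym ∘ rank-injective σ) b≻c))

record Agree (a b : Fin k) (σ τ : Ranking k) : Set where
  constructor _,_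
  field
    agreeˡ : a ≫[ σ ] b → a ≫[ τ ] b
    agreeʳ : b ≫[ σ ] a → b ≫[ τ ] a


agree-sym : {a b : Fin k} {σ τ : Ranking k} → Agree a b σ τ → Agree b a σ τ
agree-sym (p , q) = q , p

agree-up : {a b c : Fin k} (σ : Ranking k) → a ≢ c → b ≢ c → Agree a b σ (up c σ)
agree-up {c = c} σ a≢c b≢c = up-mono c σ a≢c b≢c , up-mono c σ b≢c a≢c

-- Two voters

record Unmanipulable (h : Ranking k → Ranking k → Fin k) : Set where
  constructor _,_
  field
    unmanipulable₁ : ∀ x x' y → ¬ h x' y ≫[ x ] h x y
    unmanipulable₂ : ∀ x y y' → ¬ h x y' ≫[ y ] h x y

unmanipulable-flip : {h : Ranking k → Ranking k → Fin k} → Unmanipulable h → Unmanipulable (flip h)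
unmanipulable-flip (p , q) = (λ x x' y → q y x x') , (λ x y y' → p y y' x)

-- The menu that the second vote `y` leaves to the first voter. With `flip h` it is the menu of the
-- second voter.
Option : (Ranking k → Ranking k → Fin k) → Ranking k → Fin k → Set
Option h y a = ∃ λ x → h x y ≡ a

option-max : {h : Ranking k → Ranking k → Fin k} → Unmanipulable h → ∀ {x y a} →
  Option h y a → ¬ a ≫[ x ] h x y
option-max (sp , _) {x} {y} (x' , refl) = sp x x' y

option-top : {h : Ranking k → Ranking k → Fin k} → Unmanipulable h → ∀ {x y a} →
  Option h y a → (∀ {b} → b ≢ a → a ≫[ x ] b) → h x y ≡ a
option-top {h = h} sp {x} {y} {a} o top with h x y F.≟ a
... | yes eq = eq
... | no neq = contradiction (top neq) (option-max sp o)

-- Let `x₁` rank `a` first and `b` second; it elects `a` at `y`. It cannot elect `b` at `y'`: the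
-- two votes order `a` and `b` alike, so voter 2 would gain by reporting one of them in place of the
-- other. If it elected a third outcome at `y'`, neither `a` nor `b` would be on the menu there, and
-- `absurd` excludes this.
option-persists : {h : Ranking k → Ranking k → Fin k} → Unmanipulable h →
  ∀ {a b y y'} → a ≢ b → Agree a b y y' → Option h y a → Option h y b → Option h y' a
option-persists {h = h} sp {a} {b} {y} {y'} a≢b (agˡ , _) oa ob = result
  where
  spᵗ = unmanipulable-flip {h = h} sp
  x₀ = proj₁ oa
  x₁ = up a (up b x₀)

  not-outside : ∀ {e} → h x₁ y' ≡ e → e ≢ a → e ≢ b → ⊥
  not-outside {e} eq e≢a e≢b = absurd
    where
    ¬oa : ¬ Option h y' a
    ¬oa o = option-max sp o (subst (a ≫[ x₁ ]_) (sym eq) (up-top a (up b x₀) e≢a))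
    ¬ob : ¬ Option h y' b
    ¬ob o = option-max sp o (subst (b ≫[ x₁ ]_) (sym eq)
      (up-mono a (up b x₀) (a≢b ∘ sym) e≢a (up-top b x₀ e≢b)))

    -- The outcome `e` is on the menu at `y'` because `x₁` elects it; with `a` and `b` missing it is
    -- the best available one for a ranking that places it third.
    abe : ∀ {a b} → a ≢ b → e ≢ a → e ≢ b → ¬ Option h y' a → ¬ Option h y' b →
      h (up a (up b (up e x₀))) y' ≡ e
    abe {a} {b} a≢b e≢a e≢b ¬oa ¬ob with h (up a (up b (up e x₀))) y' F.≟ e
    ... | yes eq' = eq'
    ... | no neq = contradiction
      (up-mono a _ e≢a (λ g≡a → ¬oa (_ , g≡a))
        (up-mono b _ e≢b (λ g≡b → ¬ob (_ , g≡b)) (up-top e x₀ neq)))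
      (option-max sp (x₁ , eq))

    top₂ : ∀ {a b c} {σ : Ranking _} → b ≢ a → c ≢ a → c ≢ b → b ≫[ up a (up b σ) ] c
    top₂ b≢a c≢a c≢b = up-mono _ _ b≢a c≢a (up-top _ _ c≢b)

    -- With x = a>b>e>…, x' = b>a>e>… and z = b>e>a>…, voter 2 offers h x z ∈ {b, e} and
    -- voter 1 offers h x z ∈ {a, b}, so b is available to voter 2 at x.
    second : ∀ {a b} → a ≢ b → e ≢ a → e ≢ b → ¬ Option h y' a → ¬ Option h y' b →
      Option h y b → Option (flip h) (up a (up b (up e x₀))) b
    second {a} {b} a≢b e≢a e≢b ¬oa ¬ob ob = z , decide
      where
      x = up a (up b (up e x₀))
      x' = up b (up a (up e x₀))
      z = up b (up e y)
      x'-chooses-b : h x' z ≡ b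
      x'-chooses-b = option-top spᵗ
        (y , option-top sp ob (up-top b _)) (up-top b _)
      ¬third : h x z ≢ b → h x z ≢ a → ⊥
      ¬third ≢b ≢a = option-max sp (x' , x'-chooses-b) (top₂ (a≢b ∘ sym) ≢a ≢b)
      decide : h x z ≡ b
      decide with h x z F.≟ b
      ... | yes eq' = eq'
      ... | no ≢b with h x z F.≟ a
      ...   | no ≢a = ⊥-elim (¬third ≢b ≢a)
      ...   | yes ≡a = contradiction
        (subst (e ≫[ z ]_) (sym ≡a) (top₂ e≢b a≢b (e≢a ∘ sym)))
        (option-max spᵗ (y' , abe a≢b e≢a e≢b ¬oa ¬ob))

    -- Let voter 1 top the one of `a` and `b` that `y` likes less. It is elected at `y`, although
    -- `second` puts the other one on the menu of voter 2.
    absurd : ⊥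
    absurd with ≫-total y a≢b
    ... | inj₁ a≻b = option-max spᵗ (second (a≢b ∘ sym) e≢b e≢a ¬ob ¬oa oa)
      (subst (a ≫[ y ]_) (sym (option-top sp ob (up-top b _))) a≻b)
    ... | inj₂ b≻a = option-max spᵗ (second a≢b e≢a e≢b ¬oa ¬ob ob)
      (subst (b ≫[ y ]_) (sym (option-top sp oa (up-top a _))) b≻a)

  chooses-a : h x₁ y ≡ a
  chooses-a = option-top sp oa (up-top a _)

  result : Option h y' a
  result with h x₁ y' F.≟ a
  ... | yes eq = x₁ , eq
  ... | no ≢a with h x₁ y' F.≟ b
  ...   | no ≢b  = ⊥-elim (not-outside refl ≢a ≢b)
  ...   | yes ≡b with ≫-total y a≢b
  ...     | inj₁ a≻b = contradiction (subst (a ≫[ y' ]_) (sym ≡b) (agˡ a≻b))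
                         (option-max spᵗ (y , chooses-a))
  ...     | inj₂ b≻a = contradiction (subst (b ≫[ y ]_) (sym chooses-a) b≻a)
                         (option-max spᵗ (y' , ≡b))

-- The votes are moved until one profile must elect both `c` and `d`. Raising `c` or `d` to the top
-- of vote 2 puts it on the menu of voter 1. To keep it there while vote 2 changes further,
-- `option-persists` needs a companion on the menu whose order relative to it stays the same; this
-- is `e`. In the end voter 1 tops whichever of `c` and `d` ranks higher in `x`, voter 2 tops the
-- other, and each of them finds the chosen outcome on the menu.
no-three-options : {h : Ranking k → Ranking k → Fin k} → Unmanipulable h →
  ∀ {a b c d x y} → a ≢ b → c ≢ d → c ≢ a → c ≢ b →
  Option h y a → Option h y b → Option (flip h) x c → Option (flip h) x d → ⊥
no-three-options {k} {h} sp {a} {b} {c} {d} {x} {y} a≢b c≢d c≢a c≢b oa ob oc od =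
  finish pick (≫-total x c≢d)
  where
  spᵗ = unmanipulable-flip {h = h} sp
  y₁ = up c y
  agree₁ = agree-up {a = a} {b} y (c≢a ∘ sym) (c≢b ∘ sym)
  y₂ = up d y₁
  y₃ = up c y₂

  chooses : ∀ {p σ} → Option (flip h) x p → h x (up p σ) ≡ p
  chooses o = option-top spᵗ o (up-top _ _)

  -- Raising `c` does not disturb the order of `a` and `b`, so both remain on the menu, and at least
  -- one of them differs from `d`.
  pick : Σ[ e ∈ Fin k ] e ≢ d × e ≢ c × Option h y₁ e
  pick with a F.≟ d
  ... | no a≢d = a , a≢d , c≢a ∘ sym , option-persists sp a≢b agree₁ oa ob
  ... | yes refl = b , a≢b ∘ sym , c≢b ∘ sym ,
    option-persists sp (a≢b ∘ sym) (agree-sym agree₁) ob oa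

  finish : Σ[ e ∈ Fin k ] e ≢ d × e ≢ c × Option h y₁ e → c ≫[ x ] d ⊎ d ≫[ x ] c → ⊥
  finish (e , e≢d , e≢c , oe) (inj₁ c≻d) = c≢d (trans (sym c-wins) d-wins)
    where
    x' = up c x
    ag : Agree d c x x'
    ag = (λ d≻c → contradiction d≻c (≫-asym c≻d)) , (λ _ → up-top c x (c≢d ∘ sym))
    c-wins : h x' y₂ ≡ c
    c-wins = option-top sp
      (option-persists sp (e≢c ∘ sym) (agree-up y₁ c≢d e≢d) (x , chooses oc) oe) (up-top c x)
    d-wins : h x' y₂ ≡ d
    d-wins = option-top spᵗ (option-persists spᵗ (c≢d ∘ sym) ag od oc) (up-top d y₁)
  finish (e , e≢d , e≢c , oe) (inj₂ d≻c) = c≢d (trans (sym c-wins) d-wins)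
    where
    x' = up d x
    ag : Agree c d x x'
    ag = (λ c≻d → contradiction c≻d (≫-asym d≻c)) , (λ _ → up-top d x c≢d)
    c-wins : h x' y₃ ≡ c
    c-wins = option-top spᵗ (option-persists spᵗ c≢d ag oc od) (up-top c y₂)
    oe₂ : Option h y₂ e
    oe₂ = option-persists sp e≢c (agree-up y₁ e≢d c≢d) oe (x , chooses oc)
    d-wins : h x' y₃ ≡ d
    d-wins = option-top sp
      (option-persists sp (e≢d ∘ sym) (agree-up y₂ (c≢d ∘ sym) e≢c) (x , chooses od) oe₂) (up-top d x)

-- Relabelling and reversing

transpose-hitˡ : (i j : Fin k) → transpose i j i ≡ j
transpose-hitˡ i j with i F.≟ i
... | yes _  = refl
... | no i≢i = contradiction refl i≢i

transpose-hitʳ : (i j : Fin k) → transpose i j j ≡ i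
transpose-hitʳ i j with j F.≟ i
... | yes j≡i = j≡i
... | no _ with j F.≟ j
...   | yes _  = refl
...   | no j≢j = contradiction refl j≢j

transpose-miss : (i j : Fin k) {l : Fin k} → l ≢ i → l ≢ j → transpose i j l ≡ l
transpose-miss i j {l} l≢i l≢j with l F.≟ i
... | yes l≡i = contradiction l≡i l≢i
... | no _ with l F.≟ j
...   | yes l≡j = contradiction l≡j l≢j
...   | no _  = refl

transpose-injective : (i j : Fin k) {l m : Fin k} → transpose i j l ≡ transpose i j m → l ≡ m
transpose-injective i j {l} {m} eq =
  trans (sym (transpose-inverse j i)) (trans (cong (transpose j i) eq) (transpose-inverse j i))

swap : Fin k → Fin k → Ranking k → Ranking k
swap c d σ = fromInjection (rank σ ∘ transpose c d) (transpose-injective c d ∘ rank-injective σ)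

rank-swap : (c d : Fin k) (σ : Ranking k) (a : Fin k) → rank (swap c d σ) a ≡ rank σ (transpose c d a)
rank-swap c d σ a = rank-fromInjection _ (transpose-injective c d ∘ rank-injective σ) a

swap-injective : (c d : Fin k) {σ τ : Ranking k} → swap c d σ ≡ swap c d τ → σ ≡ τ
swap-injective c d {σ} {τ} eq = ranking-ext λ a →
  subst (λ e → rank σ e ≡ rank τ e) (transpose-inverse c d)
    (trans (sym (rank-swap c d σ _)) (trans (cong (λ ρ → rank ρ (transpose d c a)) eq) (rank-swap c d τ _)))

opposite-injective : {i j : Fin k} → opposite i ≡ opposite j → i ≡ j
opposite-injective {_} {i} {j} eq =
  trans (sym (Fₚ.opposite-involutive i)) (trans (cong opposite eq) (Fₚ.opposite-involutive j))

opposite-anti-< : {i j : Fin k} → i F.< j → opposite j F.< opposite i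
opposite-anti-< {k} {i} {j} i<j rewrite Fₚ.opposite-prop i | Fₚ.opposite-prop j =
  ∸-monoʳ-< (s<s i<j) (Fₚ.toℕ<n j)

reversed : Ranking k → Ranking k
reversed σ = fromInjection (opposite ∘ rank σ) (rank-injective σ ∘ opposite-injective)

rank-reversed : (σ : Ranking k) (a : Fin k) → rank (reversed σ) a ≡ opposite (rank σ a)
rank-reversed σ a = rank-fromInjection _ (rank-injective σ ∘ opposite-injective) a

reversed-injective : {σ τ : Ranking k} → reversed σ ≡ reversed τ → σ ≡ τ
reversed-injective {σ = σ} {τ} eq = ranking-ext λ a → opposite-injective
  (trans (sym (rank-reversed σ a)) (trans (cong (λ ρ → rank ρ a) eq) (rank-reversed τ a)))

prefers : Fin k → Fin k → Ranking k → Bool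
prefers a b σ = does (rank σ a F.<? rank σ b)

prefers-true : {a b : Fin k} {σ : Ranking k} → a ≫[ σ ] b → prefers a b σ ≡ true
prefers-true {a = a} {b} {σ} (wrap a≻b) = dec-true (rank σ a F.<? rank σ b) a≻b

prefers-false : {a b : Fin k} {σ : Ranking k} → b ≫[ σ ] a → prefers a b σ ≡ false
prefers-false {a = a} {b} {σ} (wrap b≻a) =
  dec-false (rank σ a F.<? rank σ b) (<-asym b≻a)

prefers-agree : {a b : Fin k} {σ τ : Ranking k} → a ≢ b →
  prefers a b σ ≡ prefers a b τ → Agree a b σ τ
prefers-agree {a = a} {b} {σ} {τ} a≢b eq = to , from
  where
  to : a ≫[ σ ] b → a ≫[ τ ] b
  to a≻b with ≫-total τ a≢b
  ... | inj₁ r = r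
  ... | inj₂ r with () ← trans (sym (prefers-true a≻b)) (trans eq (prefers-false r))
  from : b ≫[ σ ] a → b ≫[ τ ] a
  from b≻a with ≫-total τ a≢b
  ... | inj₂ r = r
  ... | inj₁ r with () ← trans (sym (prefers-false b≻a)) (trans eq (prefers-true r))

prefers-swapped : {a b : Fin k} (σ : Ranking k) → a ≢ b → prefers b a σ ≡ not (prefers a b σ)
prefers-swapped {a = a} {b} σ a≢b with ≫-total σ a≢b
... | inj₁ a≻b = trans (prefers-false a≻b) (cong not (sym (prefers-true a≻b)))
... | inj₂ b≻a = trans (prefers-true b≻a) (cong not (sym (prefers-false b≻a)))

prefers-trans : (a b c : Fin k) (σ : Ranking k) {u : Bool} →
  prefers a b σ ≡ u → prefers b c σ ≡ u → prefers a c σ ≡ u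
prefers-trans a b c σ {true} p q = dec-true (_ F.<? _)
  (<-trans (above a b p) (above b c q))
  where
  above : ∀ a b → prefers a b σ ≡ true → rank σ a F.< rank σ b
  above a b p = <ᵇ⇒< _ _ (subst Bool.T (sym p) tt)
prefers-trans a b c σ {false} p q = dec-false (_ F.<? _)
  (≤⇒≯ (≤-trans (below b c q) (below a b p)))
  where
  below : ∀ a b → prefers a b σ ≡ false → rank σ b F.≤ rank σ a
  below a b p = ≮⇒≥ λ lt → contradiction (trans (sym (dec-true (_ F.<? _) lt)) p) λ ()

prefers-reversed : {a b : Fin k} (σ : Ranking k) → a ≢ b →
  prefers a b (reversed σ) ≡ not (prefers a b σ)
prefers-reversed {a = a} {b} σ a≢b = cases (≫-total σ a≢b)
  where
  reverses : ∀ {a b} → a ≫[ σ ] b → b ≫[ reversed σ ] a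
  reverses (wrap r) = wrap (subst₂ F._<_ (sym (rank-reversed σ _)) (sym (rank-reversed σ _))
    (opposite-anti-< r))
  cases : a ≫[ σ ] b ⊎ b ≫[ σ ] a → prefers a b (reversed σ) ≡ not (prefers a b σ)
  cases (inj₁ r) = trans (prefers-false (reverses r)) (cong not (sym (prefers-true r)))
  cases (inj₂ r) = trans (prefers-true (reverses r)) (cong not (sym (prefers-false r)))

prefers-swap : (c d : Fin k) (σ : Ranking k) {a b a' b' : Fin k} →
  transpose c d a ≡ a' → transpose c d b ≡ b' → prefers a b (swap c d σ) ≡ prefers a' b' σ
prefers-swap c d σ {a} {b} refl refl =
  cong₂ (λ i j → does (i F.<? j)) (rank-swap c d σ a) (rank-swap c d σ b)

FlipsSecond : (a b c d : Fin k) (σ τ : Ranking k) → Set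
FlipsSecond a b c d σ τ = prefers a b τ ≡ prefers a b σ × prefers c d τ ≡ not (prefers c d σ)

-- If exchanging c and d disturbs the order of a and b, then the common candidate lay between
-- the other two, and exchanging a and b repairs this without touching c versus d.
swap-flips : {a b c d : Fin k} (σ : Ranking k) → a ≢ b → c ≢ d → c ≢ a → c ≢ b →
  FlipsSecond a b c d σ (swap c d σ) ⊎ FlipsSecond a b c d σ (swap a b (swap c d σ))
swap-flips {k} {a} {b} {c} {d} σ a≢b c≢d c≢a c≢b = cases (d F.≟ a) (d F.≟ b)
  where
  flipped : prefers c d (swap c d σ) ≡ not (prefers c d σ)
  flipped = trans (prefers-swap c d σ (transpose-hitˡ c d) (transpose-hitʳ c d)) (prefers-swapped σ c≢d)
  ab-flips : ∀ τ → prefers a b (swap a b τ) ≡ not (prefers a b τ)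
  ab-flips τ = trans (prefers-swap a b τ (transpose-hitˡ a b) (transpose-hitʳ a b)) (prefers-swapped τ a≢b)
  repaired : prefers a b (swap c d σ) ≢ prefers a b σ →
    prefers a b (swap a b (swap c d σ)) ≡ prefers a b σ
  repaired ne = trans (ab-flips (swap c d σ)) (sym (¬-not (ne ∘ sym)))

  cases : _ → _ → _
  cases (no d≢a) (no d≢b) = inj₁
    (prefers-swap c d σ (transpose-miss c d (c≢a ∘ sym) (d≢a ∘ sym))
                        (transpose-miss c d (c≢b ∘ sym) (d≢b ∘ sym)) , flipped)
  cases (yes refl) _ with prefers a b (swap c a σ) Boolₚ.≟ prefers a b σ
  ... | yes eq = inj₁ (eq , flipped)
  ... | no ne  = inj₂ (repaired ne , (begin
    prefers c a (swap a b (swap c a σ)) ≡⟨ prefers-swap a b (swap c a σ) (transpose-miss a b c≢a c≢b) (transpose-hitˡ a b) ⟩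
    prefers c b (swap c a σ)            ≡⟨ prefers-swap c a σ (transpose-hitˡ c a) (transpose-miss c a (c≢b ∘ sym) (a≢b ∘ sym)) ⟩
    prefers a b σ                       ≡⟨ prefers-trans a b c σ refl bc ⟨
    prefers a c σ                       ≡⟨ prefers-swapped σ c≢a ⟩
    not (prefers c a σ)                 ∎))
    where
    open ≡-Reasoning
    bc : prefers b c σ ≡ prefers a b σ
    bc = begin
      prefers b c σ ≡⟨ prefers-swapped σ c≢b ⟩
      not (prefers c b σ) ≡⟨ cong not (prefers-swap c a σ (transpose-hitʳ c a) (transpose-miss c a (c≢b ∘ sym) (a≢b ∘ sym))) ⟨
      not (prefers a b (swap c a σ)) ≡⟨ ¬-not (ne ∘ sym) ⟨
      prefers a b σ ∎
  cases (no _) (yes refl) with prefers a b (swap c b σ) Boolₚ.≟ prefers a b σ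
  ... | yes eq = inj₁ (eq , flipped)
  ... | no ne  = inj₂ (repaired ne , (begin
    prefers c b (swap a b (swap c b σ)) ≡⟨ prefers-swap a b (swap c b σ) (transpose-miss a b c≢a c≢b) (transpose-hitʳ a b) ⟩
    prefers c a (swap c b σ)            ≡⟨ prefers-swap c b σ (transpose-hitˡ c b) (transpose-miss c b (c≢a ∘ sym) a≢b) ⟩
    prefers b a σ                       ≡⟨ prefers-swapped σ a≢b ⟩
    not (prefers a b σ)                 ≡⟨ cong not (prefers-trans c a b σ ca refl) ⟨
    not (prefers c b σ)                 ∎))
    where
    open ≡-Reasoning
    ca : prefers c a σ ≡ prefers a b σ
    ca = begin
      prefers c a σ ≡⟨ prefers-swapped σ (c≢a ∘ sym) ⟩
      not (prefers a c σ) ≡⟨ cong not (prefers-swap c b σ (transpose-miss c b (c≢a ∘ sym) a≢b) (transpose-hitʳ c b)) ⟨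
      not (prefers a b (swap c b σ)) ≡⟨ ¬-not (ne ∘ sym) ⟨
      prefers a b σ ∎

-- Finite sums

∑ : List A → (A → ℕ) → ℕ
∑ []       f = 0
∑ (x ∷ xs) f = f x + ∑ xs f

syntax ∑ xs (λ x → e) = ∑[ x ∈ xs ] e

∑-cong : ∀ (xs : List A) {f g : A → ℕ} → (∀ x → f x ≡ g x) → ∑ xs f ≡ ∑ xs g
∑-cong []       eq = refl
∑-cong (x ∷ xs) eq = cong₂ _+_ (eq x) (∑-cong xs eq)

∑-mono : ∀ (xs : List A) {f g : A → ℕ} → (∀ x → f x ≤ g x) → ∑ xs f ≤ ∑ xs g
∑-mono []       le = z≤n
∑-mono (x ∷ xs) le = +-mono-≤ (le x) (∑-mono xs le)

∑-distrib-+ : ∀ (xs : List A) (f g : A → ℕ) → ∑[ x ∈ xs ] (f x + g x) ≡ ∑ xs f + ∑ xs g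
∑-distrib-+ []       f g = refl
∑-distrib-+ (x ∷ xs) f g = trans (cong (f x + g x +_) (∑-distrib-+ xs f g))
  (interchange (f x) (g x) (∑ xs f) (∑ xs g))
  where
  interchange : ∀ a b c d → a + b + (c + d) ≡ a + c + (b + d)
  interchange = solve-∀

∑-*ˡ : ∀ (xs : List A) c (f : A → ℕ) → ∑[ x ∈ xs ] (c * f x) ≡ c * ∑ xs f
∑-*ˡ []       c f = sym (*-zeroʳ c)
∑-*ˡ (x ∷ xs) c f = trans (cong (c * f x +_) (∑-*ˡ xs c f)) (sym (*-distribˡ-+ c (f x) _))

∑-*ʳ : ∀ (xs : List A) c (f : A → ℕ) → ∑[ x ∈ xs ] (f x * c) ≡ ∑ xs f * c
∑-*ʳ []       c f = refl
∑-*ʳ (x ∷ xs) c f = trans (cong (f x * c +_) (∑-*ʳ xs c f)) (sym (*-distribʳ-+ c (f x) _))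

∑-const : ∀ (xs : List A) c → ∑[ x ∈ xs ] c ≡ length xs * c
∑-const []       c = refl
∑-const (x ∷ xs) c = cong (c +_) (∑-const xs c)

∑-swap : ∀ (xs : List A) (ys : List B) (f : A → B → ℕ) →
  ∑[ x ∈ xs ] ∑[ y ∈ ys ] f x y ≡ ∑[ y ∈ ys ] ∑[ x ∈ xs ] f x y
∑-swap []       ys f = sym (trans (∑-const ys 0) (*-zeroʳ (length ys)))
∑-swap (x ∷ xs) ys f = trans (cong (∑ ys (f x) +_) (∑-swap xs ys f))
  (sym (∑-distrib-+ ys (f x) (λ y → ∑[ x ∈ xs ] f x y)))

∑-++ : ∀ (xs ys : List A) (f : A → ℕ) → ∑ (xs ++ ys) f ≡ ∑ xs f + ∑ ys f
∑-++ []       ys f = refl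
∑-++ (x ∷ xs) ys f = trans (cong (f x +_) (∑-++ xs ys f)) (sym (+-assoc (f x) _ _))

∑-map : ∀ (g : A → B) xs (f : B → ℕ) → ∑ (List.map g xs) f ≡ ∑ xs (f ∘ g)
∑-map g []       f = refl
∑-map g (x ∷ xs) f = cong (f (g x) +_) (∑-map g xs f)

∑-product : ∀ (g : A → B → C) xs ys (f : C → ℕ) →
  ∑ (cartesianProductWith g xs ys) f ≡ ∑[ x ∈ xs ] ∑[ y ∈ ys ] f (g x y)
∑-product g []       ys f = refl
∑-product g (x ∷ xs) ys f = trans (∑-++ (List.map (g x) ys) _ f)
  (cong₂ _+_ (∑-map (g x) ys f) (∑-product g xs ys f))

length-product : ∀ (g : A → B → C) xs ys → length (cartesianProductWith g xs ys) ≡ length xs * length ys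
length-product g []       ys = refl
length-product g (x ∷ xs) ys = trans (Listₚ.length-++ (List.map (g x) ys))
  (cong₂ _+_ (Listₚ.length-map (g x) ys) (length-product g xs ys))

∑-tabulate-suc : ∀ n (f : Fin (suc n) → ℕ) → ∑ (List.tabulate suc) f ≡ ∑ (allFin n) (f ∘ suc)
∑-tabulate-suc n f = trans (cong (λ xs → ∑ xs f) (sym (Listₚ.map-tabulate id suc))) (∑-map suc (allFin n) f)

∑-∈ : ∀ {xs : List A} {x} (f : A → ℕ) → x ∈ xs → f x ≤ ∑ xs f
∑-∈ f (here refl) = m≤m+n (f _) _
∑-∈ f (there x∈)  = ≤-trans (∑-∈ f x∈) (m≤n+m _ (f _))

-- Induction that deletes from `ys` the occurrence matching the head of `xs`. It serves twice:
-- applied to an image list it compares counts along an injection, and it bounds the length of a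
-- duplicate-free list of witnesses by an exact count.
∑-unique-≤ : ∀ {xs ys : List A} (f : A → ℕ) → Unique xs → (∀ {x} → x ∈ xs → x ∈ ys) →
  ∑ xs f ≤ ∑ ys f
∑-unique-≤ {xs = []} f u sub = z≤n
∑-unique-≤ {xs = x ∷ xs} f (x∉ ∷ u) sub with ∈-∃++ (sub (here refl))
... | ys , zs , refl = begin
  f x + ∑ xs f             ≤⟨ +-monoʳ-≤ (f x) (∑-unique-≤ f u (λ y∈ → skip (All.lookup x∉ y∈) (sub (there y∈)))) ⟩
  f x + ∑ (ys ++ zs) f     ≡⟨ cong (f x +_) (∑-++ ys zs f) ⟩
  f x + (∑ ys f + ∑ zs f)  ≡⟨ rearrange (f x) (∑ ys f) (∑ zs f) ⟩
  ∑ ys f + (f x + ∑ zs f)  ≡⟨ ∑-++ ys (x ∷ zs) f ⟨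
  ∑ (ys ++ x ∷ zs) f       ∎
  where
  open ≤-Reasoning
  rearrange : ∀ a b c → a + (b + c) ≡ b + (a + c)
  rearrange = solve-∀
  skip : ∀ {y} → x ≢ y → y ∈ ys ++ x ∷ zs → y ∈ ys ++ zs
  skip x≢y y∈ with ∈-++⁻ ys y∈
  ... | inj₁ y∈ys         = ∈-++⁺ˡ y∈ys
  ... | inj₂ (here y≡x)   = contradiction (sym y≡x) x≢y
  ... | inj₂ (there y∈zs) = ∈-++⁺ʳ ys y∈zs

∑-injective-≤ : ∀ {xs : List A} {ys : List B} (g : A → B) (f : B → ℕ) →
  (∀ {x y} → g x ≡ g y → x ≡ y) → Unique xs → (∀ y → y ∈ ys) →
  ∑ xs (f ∘ g) ≤ ∑ ys f
∑-injective-≤ {xs = xs} g f inj u complete = subst (_≤ _) (∑-map g xs f)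
  (∑-unique-≤ f (Uniqueₚ.map⁺ inj u) (λ _ → complete _))


indicator : {P : Set} → Dec P → ℕ
indicator (yes _) = 1
indicator (no _)  = 0

indicator-≤1 : {P : Set} (d : Dec P) → indicator d ≤ 1
indicator-≤1 (yes _) = ≤-refl
indicator-≤1 (no _)  = z≤n

indicator-mono : {P Q : Set} (p : Dec P) (q : Dec Q) → (P → Q) → indicator p ≤ indicator q
indicator-mono (no _)  q       P→Q = z≤n
indicator-mono (yes _) (yes _) P→Q = ≤-refl
indicator-mono (yes p) (no ¬q) P→Q = contradiction (P→Q p) ¬q

indicator-yes : {P : Set} (d : Dec P) → P → indicator d ≡ 1
indicator-yes (yes _) p = refl
indicator-yes (no ¬p) p = contradiction p ¬p

length-filter : ∀ {P : A → Set} (P? : ∀ x → Dec (P x)) xs →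
  length (filter P? xs) ≡ ∑[ x ∈ xs ] indicator (P? x)
length-filter P? [] = refl
length-filter P? (x ∷ xs) with P? x
... | yes _ = cong suc (length-filter P? xs)
... | no _  = length-filter P? xs

vecs : List A → ∀ n → List (Vec A n)
vecs xs zero    = [] ∷ []
vecs xs (suc n) = cartesianProductWith _∷_ xs (vecs xs n)

∑-vecs : ∀ (xs : List A) n (f : Vec A (suc n) → ℕ) →
  ∑ (vecs xs (suc n)) f ≡ ∑[ x ∈ xs ] ∑[ v ∈ vecs xs n ] f (x ∷ v)
∑-vecs xs n = ∑-product _∷_ xs (vecs xs n)

length-vecs : ∀ (xs : List A) n → length (vecs xs n) ≡ length xs ^ n
length-vecs xs zero    = refl
length-vecs xs (suc n) = trans (length-product _∷_ xs (vecs xs n)) (cong (length xs *_) (length-vecs xs n))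

vecs-unique : ∀ {xs : List A} → Unique xs → ∀ n → Unique (vecs xs n)
vecs-unique u zero    = [] ∷ []
vecs-unique u (suc n) = Uniqueₚ.cartesianProductWith⁺ _∷_ Vecₚ.∷-injective u (vecs-unique u n)

∈-vecs : ∀ {xs : List A} → (∀ x → x ∈ xs) → (v : Vec A n) → v ∈ vecs xs n
∈-vecs complete []      = here refl
∈-vecs complete (x ∷ v) = ∈-cartesianProductWith⁺ _∷_ (complete x) (∈-vecs complete v)

-- A uniform vector stays uniform when one coordinate is replaced by an independent uniform one:
-- each vector arises from exactly `length xs` pairs.
∑-resample : ∀ (xs : List A) n (i : Fin n) (f : Vec A n → ℕ) →
  ∑[ v ∈ vecs xs n ] ∑[ x ∈ xs ] f (v [ i ]≔ x) ≡ length xs * ∑ (vecs xs n) f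
∑-resample xs (suc n) zero f = begin
  ∑[ v ∈ vecs xs (suc n) ] ∑[ x ∈ xs ] f (v [ zero ]≔ x)    ≡⟨ ∑-vecs xs n _ ⟩
  ∑[ y ∈ xs ] ∑[ v ∈ vecs xs n ] ∑[ x ∈ xs ] f (x ∷ v)     ≡⟨ ∑-const xs _ ⟩
  length xs * ∑[ v ∈ vecs xs n ] ∑[ x ∈ xs ] f (x ∷ v)      ≡⟨ cong (length xs *_) (∑-swap (vecs xs n) xs _) ⟩
  length xs * ∑[ x ∈ xs ] ∑[ v ∈ vecs xs n ] f (x ∷ v)      ≡⟨ cong (length xs *_) (∑-vecs xs n f) ⟨
  length xs * ∑ (vecs xs (suc n)) f                         ∎
  where open ≡-Reasoning
∑-resample xs (suc n) (suc i) f = begin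
  ∑[ v ∈ vecs xs (suc n) ] ∑[ x ∈ xs ] f (v [ suc i ]≔ x)          ≡⟨ ∑-vecs xs n _ ⟩
  ∑[ y ∈ xs ] ∑[ v ∈ vecs xs n ] ∑[ x ∈ xs ] f (y ∷ v [ i ]≔ x)    ≡⟨ ∑-cong xs (λ y → ∑-resample xs n i (f ∘ (y ∷_))) ⟩
  ∑[ y ∈ xs ] (length xs * ∑[ v ∈ vecs xs n ] f (y ∷ v))           ≡⟨ ∑-*ˡ xs (length xs) _ ⟩
  length xs * ∑[ y ∈ xs ] ∑[ v ∈ vecs xs n ] f (y ∷ v)             ≡⟨ cong (length xs *_) (∑-vecs xs n f) ⟨
  length xs * ∑ (vecs xs (suc n)) f                                ∎
  where open ≡-Reasoning

pigeonhole : ∀ x (xs : List A) (f : A → ℕ) → ∃ λ y → ∑ (x ∷ xs) f ≤ length (x ∷ xs) * f y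
pigeonhole x []        f = x , ≤-refl
pigeonhole x (x' ∷ xs) f with pigeonhole x' xs f
... | m , le with ≤-total (f x) (f m)
...   | inj₁ x≤m = m , +-mono-≤ x≤m le
...   | inj₂ m≤x = x , +-monoʳ-≤ (f x) (≤-trans le (*-monoʳ-≤ (length (x' ∷ xs)) m≤x))

∃-large : ∀ (xs : List A) (f : A → ℕ) → 0 < ∑ xs f → ∃ λ x → ∑ xs f ≤ length xs * f x
∃-large (x ∷ xs) f _ = pigeonhole x xs f

^-distribʳ-* : ∀ o m n → (m * n) ^ o ≡ m ^ o * n ^ o
^-distribʳ-* zero    m n = refl
^-distribʳ-* (suc o) m n = trans (cong (m * n *_) (^-distribʳ-* o m n)) (interchange m n (m ^ o) (n ^ o))
  where
  interchange : ∀ a b c d → a * b * (c * d) ≡ a * c * (b * d)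
  interchange = solve-∀

-- Product kernels

-- Three kernels are used: all ones, equality of the comparison of two votes, and incidence of a bit
-- with a vote. Their products pick out all pairs of profiles, the pairs within a fibre, and the
-- profiles of a given fibre.
⨂ : (A → B → ℕ) → Vec A n → Vec B n → ℕ
⨂ K []      []      = 1
⨂ K (x ∷ u) (y ∷ v) = K x y * ⨂ K u v

⨂-rowsum : ∀ (K : A → B → ℕ) (ys : List B) {r} → (∀ x → ∑ ys (K x) ≡ r) →
  ∀ {n} (u : Vec A n) → ∑ (vecs ys n) (⨂ K u) ≡ r ^ n
⨂-rowsum K ys row [] = refl
⨂-rowsum K ys {r} row {suc n} (x ∷ u) = begin
  ∑ (vecs ys (suc n)) (⨂ K (x ∷ u))                    ≡⟨ ∑-vecs ys n _ ⟩
  ∑[ y ∈ ys ] ∑[ v ∈ vecs ys n ] (K x y * ⨂ K u v)    ≡⟨ ∑-cong ys (λ y → trans (∑-*ˡ (vecs ys n) (K x y) _) (cong (K x y *_) (⨂-rowsum K ys row u))) ⟩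
  ∑[ y ∈ ys ] (K x y * r ^ n)                          ≡⟨ ∑-*ʳ ys (r ^ n) (K x) ⟩
  ∑ ys (K x) * r ^ n                                   ≡⟨ cong (_* r ^ n) (row x) ⟩
  r ^ suc n                                            ∎
  where open ≡-Reasoning

⨂-flip : ∀ (K : A → B → ℕ) (u : Vec A n) (v : Vec B n) → ⨂ K u v ≡ ⨂ (flip K) v u
⨂-flip K []      []      = refl
⨂-flip K (x ∷ u) (y ∷ v) = cong (K x y *_) (⨂-flip K u v)

⨂-map : ∀ (K : B → C → ℕ) (f : A → B) (u : Vec A n) (v : Vec C n) →
  ⨂ K (Vec.map f u) v ≡ ⨂ (K ∘ f) u v
⨂-map K f []      []      = refl
⨂-map K f (x ∷ u) (y ∷ v) = cong (K (f x) y *_) (⨂-map K f u v)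

module Telescope (xs : List A) (K : A → A → ℕ) (r : ℕ)
  (row : ∀ x → ∑ xs (K x) ≡ r) (col : ∀ y → ∑[ x ∈ xs ] K x y ≡ r) where

  private
    V : ∀ n → List (Vec A n)
    V = vecs xs

  steps : ∀ n (d : Vec A n → Vec A n → ℕ) → Fin n → ℕ
  steps n d l = ∑[ u ∈ V n ] ∑[ x ∈ xs ] (K (lookup u l) x * d u (u [ l ]≔ x))

  -- The triangle inequality along the path from `u` to `v` that replaces the coordinates one by
  -- one, each according to `K`. Induction splits off the first move, from `x ∷ u` to `y ∷ u`. Since
  -- `d` need not be symmetric, directed crossings may be counted.
  telescope : ∀ n (d : Vec A n → Vec A n → ℕ) → (∀ u → d u u ≡ 0) →
    (∀ u v w → d u w ≤ d u v + d v w) →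
    r * ∑[ u ∈ V n ] ∑[ v ∈ V n ] (⨂ K u v * d u v) ≤ r ^ n * ∑ (allFin n) (steps n d)
  telescope zero d d-refl tri rewrite d-refl [] = ≤-reflexive (*-zeroʳ r)
  telescope (suc n) d d-refl tri = begin
    r * ∑[ u ∈ V (suc n) ] ∑[ v ∈ V (suc n) ] (⨂ K u v * d u v)
      ≡⟨ cong (r *_) (trans (∑-vecs xs n _) (∑-cong xs λ x → ∑-cong (V n) λ u → ∑-vecs xs n _)) ⟩
    r * ∑[ x ∈ xs ] ∑[ u ∈ V n ] ∑[ y ∈ xs ] ∑[ v ∈ V n ] (K x y * ⨂ K u v * d (x ∷ u) (y ∷ v))
      ≤⟨ *-monoʳ-≤ r (∑-mono xs λ x → ∑-mono (V n) λ u → ∑-mono xs λ y → ∑-mono (V n) λ v →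
           *-monoʳ-≤ (K x y * ⨂ K u v) (tri (x ∷ u) (y ∷ u) (y ∷ v))) ⟩
    r * ∑[ x ∈ xs ] ∑[ u ∈ V n ] ∑[ y ∈ xs ] ∑[ v ∈ V n ] (K x y * ⨂ K u v * (d (x ∷ u) (y ∷ u) + d (y ∷ u) (y ∷ v)))
      ≡⟨ cong (r *_) (trans (∑-cong xs λ x → trans (∑-cong (V n) λ u → trans (∑-cong xs λ y → split x u y) (∑-distrib-+ xs _ _)) (∑-distrib-+ (V n) _ _)) (∑-distrib-+ xs _ _)) ⟩
    r * (∑[ x ∈ xs ] ∑[ u ∈ V n ] ∑[ y ∈ xs ] (r ^ n * (K x y * d (x ∷ u) (y ∷ u)))
       + ∑[ x ∈ xs ] ∑[ u ∈ V n ] ∑[ y ∈ xs ] (K x y * rest y u))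
      ≡⟨ cong₂ (λ s t → r * (s + t)) first second ⟩
    r * (r ^ n * steps (suc n) d zero + r * ∑ xs W)
      ≡⟨ *-distribˡ-+ r _ _ ⟩
    r * (r ^ n * steps (suc n) d zero) + r * (r * ∑ xs W)
      ≤⟨ +-monoʳ-≤ _ (*-monoʳ-≤ r (begin
        r * ∑ xs W                        ≡⟨ ∑-*ˡ xs r W ⟨
        ∑[ y ∈ xs ] (r * W y)             ≤⟨ ∑-mono xs (λ y → telescope n (d' y) (λ u → d-refl (y ∷ u)) (λ u v w → tri (y ∷ u) (y ∷ v) (y ∷ w))) ⟩
        ∑[ y ∈ xs ] (r ^ n * ∑ (allFin n) (steps n (d' y))) ≡⟨ ∑-*ˡ xs (r ^ n) _ ⟩
        r ^ n * ∑[ y ∈ xs ] ∑ (allFin n) (steps n (d' y))   ≡⟨ cong (r ^ n *_) later ⟩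
        r ^ n * ∑[ l ∈ allFin n ] steps (suc n) d (suc l)   ∎)) ⟩
    r * (r ^ n * steps (suc n) d zero) + r * (r ^ n * ∑[ l ∈ allFin n ] steps (suc n) d (suc l))
      ≡⟨ collect r (r ^ n) (steps (suc n) d zero) _ ⟩
    r ^ suc n * (steps (suc n) d zero + ∑[ l ∈ allFin n ] steps (suc n) d (suc l))
      ≡⟨ cong (λ s → r ^ suc n * (steps (suc n) d zero + s)) (∑-tabulate-suc n (steps (suc n) d)) ⟨
    r ^ suc n * ∑ (allFin (suc n)) (steps (suc n) d) ∎
    where
    open ≤-Reasoning
    d' : A → Vec A n → Vec A n → ℕ
    d' y u v = d (y ∷ u) (y ∷ v)
    rest : A → Vec A n → ℕ
    rest y u = ∑[ v ∈ V n ] (⨂ K u v * d' y u v)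
    W : A → ℕ
    W y = ∑ (V n) (rest y)
    collect : ∀ a b c e → a * (b * c) + a * (b * e) ≡ a * b * (c + e)
    collect = solve-∀
    expand : ∀ k m a b → k * m * (a + b) ≡ (k * a) * m + k * (m * b)
    expand = solve-∀
    split : ∀ x u y → ∑[ v ∈ V n ] (K x y * ⨂ K u v * (d (x ∷ u) (y ∷ u) + d (y ∷ u) (y ∷ v)))
      ≡ r ^ n * (K x y * d (x ∷ u) (y ∷ u)) + K x y * rest y u
    split x u y = trans (∑-cong (V n) λ v → expand (K x y) (⨂ K u v) _ _)
      (trans (∑-distrib-+ (V n) _ _) (cong₂ _+_
        (trans (∑-*ˡ (V n) (K x y * d (x ∷ u) (y ∷ u)) (⨂ K u))
          (trans (*-comm (K x y * d (x ∷ u) (y ∷ u)) _) (cong (_* (K x y * d (x ∷ u) (y ∷ u))) (⨂-rowsum K xs row u))))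
        (∑-*ˡ (V n) (K x y) _)))
    first : ∑[ x ∈ xs ] ∑[ u ∈ V n ] ∑[ y ∈ xs ] (r ^ n * (K x y * d (x ∷ u) (y ∷ u)))
      ≡ r ^ n * steps (suc n) d zero
    first = trans (∑-cong xs λ x → trans (∑-cong (V n) λ u → ∑-*ˡ xs (r ^ n) _) (∑-*ˡ (V n) (r ^ n) _))
      (trans (∑-*ˡ xs (r ^ n) _) (cong (r ^ n *_) (sym (∑-vecs xs n _))))
    -- Here the column sums enter: after the move of the first coordinate the vector `y ∷ u` is
    -- again uniform, so the induction hypothesis applies to the rest of the path.
    second : ∑[ x ∈ xs ] ∑[ u ∈ V n ] ∑[ y ∈ xs ] (K x y * rest y u) ≡ r * ∑ xs W
    second = begin-equality
      ∑[ x ∈ xs ] ∑[ u ∈ V n ] ∑[ y ∈ xs ] (K x y * rest y u) ≡⟨ ∑-cong xs (λ x → trans (∑-swap (V n) xs _) (∑-cong xs λ y → ∑-*ˡ (V n) (K x y) (rest y))) ⟩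
      ∑[ x ∈ xs ] ∑[ y ∈ xs ] (K x y * W y)                   ≡⟨ ∑-swap xs xs _ ⟩
      ∑[ y ∈ xs ] ∑[ x ∈ xs ] (K x y * W y)                   ≡⟨ ∑-cong xs (λ y → trans (∑-*ʳ xs (W y) (λ x → K x y)) (cong (_* W y) (col y))) ⟩
      ∑[ y ∈ xs ] (r * W y)                                   ≡⟨ ∑-*ˡ xs r W ⟩
      r * ∑ xs W                                              ∎
    later : ∑[ y ∈ xs ] ∑ (allFin n) (steps n (d' y)) ≡ ∑[ l ∈ allFin n ] steps (suc n) d (suc l)
    later = trans (∑-swap xs (allFin n) _) (∑-cong (allFin n) λ l → sym (∑-vecs xs n _))

-- Reverse hypercontractivity

2xy≤x²+y² : ∀ x y → 2 * (x * y) ≤ x * x + y * y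
2xy≤x²+y² x y with ≤-total x y
... | inj₁ x≤y with m≤n⇒∃[o]m+o≡n x≤y
...   | e , refl = ≤-trans (m≤m+n _ (e * e)) (≤-reflexive (square x e))
  where
  square : ∀ x e → 2 * (x * (x + e)) + e * e ≡ x * x + (x + e) * (x + e)
  square = solve-∀
2xy≤x²+y² x y | inj₂ y≤x with m≤n⇒∃[o]m+o≡n y≤x
...   | e , refl = ≤-trans (m≤m+n _ (e * e)) (≤-reflexive (square y e))
  where
  square : ∀ y e → 2 * ((y + e) * y) + e * e ≡ (y + e) * (y + e) + y * y
  square = solve-∀

-- The difference of the two sides is 4 (u s − v t)² + (u − v)² (s − t)².
two-point-extremal : ∀ u v s t →
  (u + v) * (u + v) * ((s + t) * (s + t)) ≤
  2 * (3 * ((u * s) * (u * s) + (v * t) * (v * t)) + ((u * t) * (u * t) + (v * s) * (v * s)))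
two-point-extremal u v s t = +-cancelʳ-≤ (4 * ((u * s) * (v * t))) _ _ (begin
  (u + v) * (u + v) * ((s + t) * (s + t)) + 4 * ((u * s) * (v * t))
    ≡⟨ left u v s t ⟩
  E + 4 * (2 * (a * b)) + 2 * ((a + b) * (c + d))
    ≤⟨ +-mono-≤ (+-monoʳ-≤ E (*-monoʳ-≤ 4 (2xy≤x²+y² a b))) (2xy≤x²+y² (a + b) (c + d)) ⟩
  E + 4 * (a * a + b * b) + ((a + b) * (a + b) + (c + d) * (c + d))
    ≡⟨ right u v s t ⟩
  2 * (3 * (a * a + b * b) + (c * c + d * d)) + 4 * (a * b) ∎)
  where
  open ≤-Reasoning
  a = u * s
  b = v * t
  c = u * t
  d = v * s
  E = a * a + b * b + (c * c + d * d)
  left : ∀ u v s t → (u + v) * (u + v) * ((s + t) * (s + t)) + 4 * ((u * s) * (v * t)) ≡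
    (u * s) * (u * s) + (v * t) * (v * t) + ((u * t) * (u * t) + (v * s) * (v * s))
      + 4 * (2 * ((u * s) * (v * t))) + 2 * ((u * s + v * t) * (u * t + v * s))
  left = solve-∀
  right : ∀ u v s t →
    (u * s) * (u * s) + (v * t) * (v * t) + ((u * t) * (u * t) + (v * s) * (v * s))
      + 4 * ((u * s) * (u * s) + (v * t) * (v * t))
      + ((u * s + v * t) * (u * s + v * t) + (u * t + v * s) * (u * t + v * s))
    ≡ 2 * (3 * ((u * s) * (u * s) + (v * t) * (v * t)) + ((u * t) * (u * t) + (v * s) * (v * s)))
      + 4 * ((u * s) * (v * t))
  right = solve-∀

-- With e = q - p and g = 3p - q, both nonnegative, 2(p, q) = e(1, 3) + g(1, 1). The weights (1, 3)
-- are the second hypothesis, and (1, 1) is the mean of both.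
interpolate : ∀ {p q X Y R} → p ≤ q → q ≤ 3 * p → R ≤ 2 * (3 * X + Y) → R ≤ 2 * (3 * Y + X) →
  (p + q) * R ≤ 8 * (p * X + q * Y)
interpolate {p} {q} {X} {Y} {R} p≤q q≤3p le₁ le₂ with m≤n⇒∃[o]m+o≡n p≤q
... | e , refl with m≤n⇒∃[o]m+o≡n (+-cancelˡ-≤ p e (2 * p) q≤3p)
...   | g , e+g≡2p = *-cancelˡ-≤ 2 (begin
  2 * ((p + (p + e)) * R)                              ≡⟨ lhs p e R ⟩
  2 * p * (2 * R) + 2 * (e * R)                        ≡⟨ cong (λ z → z * (2 * R) + 2 * (e * R)) e+g≡2p ⟨
  (e + g) * (2 * R) + 2 * (e * R)                      ≡⟨ mid₁ e g R ⟩
  4 * (e * R) + g * (R + R)                            ≤⟨ +-mono-≤ (*-monoʳ-≤ 4 (*-monoʳ-≤ e le₂)) (*-monoʳ-≤ g (+-mono-≤ le₁ le₂)) ⟩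
  4 * (e * (2 * (3 * Y + X))) + g * (2 * (3 * X + Y) + 2 * (3 * Y + X)) ≡⟨ mid₂ e g X Y ⟩
  8 * ((e + g) * (X + Y)) + 16 * (e * Y)               ≡⟨ cong (λ z → 8 * (z * (X + Y)) + 16 * (e * Y)) e+g≡2p ⟩
  8 * (2 * p * (X + Y)) + 16 * (e * Y)                 ≡⟨ rhs p e X Y ⟩
  2 * (8 * (p * X + (p + e) * Y))                      ∎)
  where
  open ≤-Reasoning
  lhs : ∀ p e R → 2 * ((p + (p + e)) * R) ≡ 2 * p * (2 * R) + 2 * (e * R)
  lhs = solve-∀
  mid₁ : ∀ e g R → (e + g) * (2 * R) + 2 * (e * R) ≡ 4 * (e * R) + g * (R + R)
  mid₁ = solve-∀
  mid₂ : ∀ e g X Y → 4 * (e * (2 * (3 * Y + X))) + g * (2 * (3 * X + Y) + 2 * (3 * Y + X)) ≡ 8 * ((e + g) * (X + Y)) + 16 * (e * Y)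
  mid₂ = solve-∀
  rhs : ∀ p e X Y → 8 * (2 * p * (X + Y)) + 16 * (e * Y) ≡ 2 * (8 * (p * X + (p + e) * Y))
  rhs = solve-∀

-- The case of one bit: E[FG] is at least the product of the L^(1/2) norms for F = (u², v²) and G =
-- (s², t²), where p and q weigh agreement and disagreement. Being linear in (p, q), it follows from
-- the ratios 3:1 and 1:3, which exchanging `s` and `t` carries into each other.
two-point : ∀ {p q} → p ≤ 3 * q → q ≤ 3 * p → ∀ u v s t →
  (p + q) * ((u + v) * (u + v) * ((s + t) * (s + t))) ≤
  8 * (p * ((u * s) * (u * s) + (v * t) * (v * t)) + q * ((u * t) * (u * t) + (v * s) * (v * s)))
two-point {p} {q} p≤3q q≤3p u v s t = cases (≤-total p q)
  where
  R = (u + v) * (u + v) * ((s + t) * (s + t))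
  X = (u * s) * (u * s) + (v * t) * (v * t)
  Y = (u * t) * (u * t) + (v * s) * (v * s)
  extremal : R ≤ 2 * (3 * X + Y)
  extremal = two-point-extremal u v s t
  extremal′ : R ≤ 2 * (3 * Y + X)
  extremal′ = subst (λ z → (u + v) * (u + v) * (z * z) ≤ 2 * (3 * Y + X)) (+-comm t s) (two-point-extremal u v t s)
  cases : p ≤ q ⊎ q ≤ p → (p + q) * R ≤ 8 * (p * X + q * Y)
  cases (inj₁ p≤q) = interpolate {p} {q} {X} {Y} p≤q q≤3p extremal extremal′
  cases (inj₂ q≤p) = subst₂ (λ a b → a * R ≤ 8 * b) (+-comm q p) (+-comm (q * Y) (p * X))
    (interpolate {q} {p} {Y} {X} q≤p p≤3q extremal′ extremal)

bools : List Bool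
bools = true ∷ false ∷ []

same : Bool → Bool → ℕ
same true  true  = 1
same true  false = 0
same false true  = 0
same false false = 1

same-comm : ∀ u v → same u v ≡ same v u
same-comm true  true  = refl
same-comm true  false = refl
same-comm false true  = refl
same-comm false false = refl

same-mono : ∀ u v {m m'} → (u ≡ v → m ≤ m') → same u v * m ≤ same u v * m'
same-mono true  true  le = *-monoʳ-≤ 1 (le refl)
same-mono true  false le = z≤n
same-mono false true  le = z≤n
same-mono false false le = *-monoʳ-≤ 1 (le refl)

∑-bools : (f : Bool → ℕ) → ∑ bools f ≡ f true + f false
∑-bools f = cong (f true +_) (+-identityʳ (f false))

∑-same : ∀ u (f : Bool → ℕ) → ∑[ v ∈ bools ] (same u v * f v) ≡ f u
∑-same true  f = trans (+-identityʳ _) (+-identityʳ _)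
∑-same false f = trans (+-identityʳ _) (+-identityʳ _)

module Correlated (xs : List A) (z w : A → Bool) (p q : ℕ) (p≤3q : p ≤ 3 * q) (q≤3p : q ≤ 3 * p)
  (joint : ∀ u v → ∑[ x ∈ xs ] (same u (z x) * same v (w x)) ≡ same u v * p + same u (not v) * q) where

  ∑-joint : ∀ (f : Bool → Bool → ℕ) →
    ∑[ x ∈ xs ] f (z x) (w x) ≡ p * (f true true + f false false) + q * (f true false + f false true)
  ∑-joint f = begin
    ∑[ x ∈ xs ] f (z x) (w x)
      ≡⟨ ∑-cong xs (λ x → trans (sym (∑-same (z x) (λ u → f u (w x)))) (∑-cong bools λ u → cong (same (z x) u *_) (sym (∑-same (w x) (f u))))) ⟩
    ∑[ x ∈ xs ] ∑[ u ∈ bools ] (same (z x) u * ∑[ v ∈ bools ] (same (w x) v * f u v))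
      ≡⟨ ∑-swap xs bools (λ x u → same (z x) u * ∑[ v ∈ bools ] (same (w x) v * f u v)) ⟩
    ∑[ u ∈ bools ] ∑[ x ∈ xs ] (same (z x) u * ∑[ v ∈ bools ] (same (w x) v * f u v))
      ≡⟨ ∑-cong bools (λ u → trans
           (∑-cong xs λ x → sym (∑-*ˡ bools (same (z x) u) (λ v → same (w x) v * f u v)))
           (∑-swap xs bools (λ x v → same (z x) u * (same (w x) v * f u v)))) ⟩
    ∑[ u ∈ bools ] ∑[ v ∈ bools ] ∑[ x ∈ xs ] (same (z x) u * (same (w x) v * f u v))
      ≡⟨ ∑-cong bools (λ u → ∑-cong bools λ v → trans (∑-cong xs λ x → reorder (z x) u (w x) v (f u v)) (trans (∑-*ʳ xs (f u v) _) (cong (_* f u v) (joint u v)))) ⟩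
    ∑[ u ∈ bools ] ∑[ v ∈ bools ] ((same u v * p + same u (not v) * q) * f u v)
      ≡⟨ final p q (f true true) (f true false) (f false true) (f false false) ⟩
    p * (f true true + f false false) + q * (f true false + f false true) ∎
    where
    open ≡-Reasoning
    reorder : ∀ a u b v m → same a u * (same b v * m) ≡ same u a * same v b * m
    reorder a u b v m = trans (sym (*-assoc (same a u) (same b v) m)) (cong₂ (λ i j → i * j * m) (same-comm a u) (same-comm b v))
    final : ∀ p q a b c d →
      (1 * p + 0 * q) * a + ((0 * p + 1 * q) * b + 0) + ((0 * p + 1 * q) * c + ((1 * p + 0 * q) * d + 0) + 0) ≡
      p * (a + d) + q * (b + c)
    final = solve-∀

  correlation : (Vec Bool n → ℕ) → (Vec Bool n → ℕ) → ℕ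
  correlation {n} F G = ∑[ σ ∈ vecs xs n ] (F (Vec.map z σ) * G (Vec.map w σ))

  -- Bounding F and G by constants takes the place of the roots in the usual L^p norms: it enters
  -- only at n = 0, as F² ≤ c F.
  reverse-hypercontractive : ∀ n (F G : Vec Bool n → ℕ) {c c'} → (∀ y → F y ≤ c) → (∀ y → G y ≤ c') →
    (p + q) ^ n * (∑ (vecs bools n) F * ∑ (vecs bools n) F * (∑ (vecs bools n) G * ∑ (vecs bools n) G))
      ≤ 8 ^ n * (c * c') * correlation F G
  reverse-hypercontractive zero F G {c} {c'} F≤c G≤c' = begin
    1 * ((F [] + 0) * (F [] + 0) * ((G [] + 0) * (G [] + 0))) ≡⟨ lhs (F []) (G []) ⟩
    F [] * G [] * (F [] * G [] + 0)                           ≤⟨ *-monoˡ-≤ (F [] * G [] + 0) (*-mono-≤ (F≤c []) (G≤c' [])) ⟩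
    c * c' * (F [] * G [] + 0)                                ≡⟨ cong (_* (F [] * G [] + 0)) (+-identityʳ (c * c')) ⟨
    1 * (c * c') * (F [] * G [] + 0)                          ∎
    where
    open ≤-Reasoning
    lhs : ∀ f g → 1 * ((f + 0) * (f + 0) * ((g + 0) * (g + 0))) ≡ f * g * (f * g + 0)
    lhs = solve-∀
  reverse-hypercontractive (suc n) F G {c} {c'} F≤c G≤c' = begin
    (p + q) ^ suc n * (∑ (vecs bools (suc n)) F * ∑ (vecs bools (suc n)) F * (∑ (vecs bools (suc n)) G * ∑ (vecs bools (suc n)) G))
      ≡⟨ cong₂ (λ f g → (p + q) ^ suc n * (f * f * (g * g))) (halves F) (halves G) ⟩
    (p + q) * s * ((a true + a false) * (a true + a false) * ((b true + b false) * (b true + b false)))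
      ≡⟨ pull (p + q) s _ ⟩
    s * ((p + q) * ((a true + a false) * (a true + a false) * ((b true + b false) * (b true + b false))))
      -- The sums of `F` and `G` over the slices with a given first bit take the places of u, v and
      -- s, t. The induction hypothesis, one instance for each pair of slices, then bounds the
      -- squares of their products.
      ≤⟨ *-monoʳ-≤ s (two-point p≤3q q≤3p (a true) (a false) (b true) (b false)) ⟩
    s * (8 * (p * (sq true true + sq false false) + q * (sq true false + sq false true)))
      ≡⟨ push s p q (sq true true) (sq false false) (sq true false) (sq false true) ⟩
    8 * (p * (s * sq true true + s * sq false false) + q * (s * sq true false + s * sq false true))
      ≤⟨ *-monoʳ-≤ 8 (+-mono-≤ (*-monoʳ-≤ p (+-mono-≤ (ih true true) (ih false false)))
                               (*-monoʳ-≤ q (+-mono-≤ (ih true false) (ih false true)))) ⟩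
    8 * (p * (κ * Q true true + κ * Q false false) + q * (κ * Q true false + κ * Q false true))
      ≡⟨ cong (8 *_) (∑-joint (λ u v → κ * Q u v)) ⟨
    8 * ∑[ x ∈ xs ] (κ * Q (z x) (w x))
      ≡⟨ cong (8 *_) (∑-*ˡ xs κ _) ⟩
    8 * (κ * ∑[ x ∈ xs ] Q (z x) (w x))
      ≡⟨ cong (λ o → 8 * (κ * o)) (∑-vecs xs n _) ⟨
    8 * (κ * correlation F G)
      ≡⟨ regroup (8 ^ n) (c * c') (correlation F G) ⟩
    8 ^ suc n * (c * c') * correlation F G ∎
    where
    open ≤-Reasoning
    s = (p + q) ^ n
    κ = 8 ^ n * (c * c')
    a b : Bool → ℕ
    a u = ∑ (vecs bools n) (F ∘ (u ∷_))
    b v = ∑ (vecs bools n) (G ∘ (v ∷_))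
    Q sq : Bool → Bool → ℕ
    Q u v = correlation (F ∘ (u ∷_)) (G ∘ (v ∷_))
    sq u v = (a u * b v) * (a u * b v)
    halves : ∀ (H : Vec Bool (suc n) → ℕ) → ∑ (vecs bools (suc n)) H
      ≡ ∑ (vecs bools n) (H ∘ (true ∷_)) + ∑ (vecs bools n) (H ∘ (false ∷_))
    halves H = trans (∑-vecs bools n H) (∑-bools λ u → ∑ (vecs bools n) (H ∘ (u ∷_)))
    squares : ∀ x y → (x * y) * (x * y) ≡ x * x * (y * y)
    squares = solve-∀
    ih : ∀ u v → s * sq u v ≤ κ * Q u v
    ih u v = subst (λ m → s * m ≤ κ * Q u v) (sym (squares (a u) (b v)))
      (reverse-hypercontractive n (F ∘ (u ∷_)) (G ∘ (v ∷_)) (λ y → F≤c (u ∷ y)) (λ y → G≤c' (v ∷ y)))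
    pull : ∀ x s R → x * s * R ≡ s * (x * R)
    pull = solve-∀
    push : ∀ s p q x y x' y' → s * (8 * (p * (x + y) + q * (x' + y'))) ≡ 8 * (p * (s * x + s * y) + q * (s * x' + s * y'))
    push = solve-∀
    regroup : ∀ e c o → 8 * (e * c * o) ≡ 8 * e * c * o
    regroup = solve-∀

-- The joint law of two pairwise comparisons

length-rankings : ∀ k → length (rankings k) ≡ k !
length-rankings zero    = refl
length-rankings (suc k) = trans (length-product extend (allFin (suc k)) (rankings k))
  (cong₂ _*_ (Listₚ.length-tabulate {n = suc k} id) (length-rankings k))

same-not-not : ∀ u v → same (not u) (not v) ≡ same u v
same-not-not true  true  = refl
same-not-not true  false = refl
same-not-not false true  = refl
same-not-not false false = refl

module Joint {k} {a b c d : Fin k} (a≢b : a ≢ b) (c≢d : c ≢ d) (c≢a : c ≢ a) (c≢b : c ≢ b) where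

  private
    z w : Ranking k → Bool
    z = prefers a b
    w = prefers c d

    cell : Bool → Bool → Ranking k → ℕ
    cell u v x = same u (z x) * same v (w x)

  cells : Bool → Bool → ℕ
  cells u v = ∑ (rankings k) (cell u v)

  p q : ℕ
  p = cells true true
  q = cells true false

  cells-reverse : ∀ u v → cells u v ≤ cells (not u) (not v)
  cells-reverse u v = subst (_≤ cells (not u) (not v))
    (∑-cong (rankings k) λ x → cong₂ _*_
      (trans (cong (same (not u)) (prefers-reversed x a≢b)) (same-not-not u (z x)))
      (trans (cong (same (not v)) (prefers-reversed x c≢d)) (same-not-not v (w x))))
    (∑-injective-≤ reversed (cell (not u) (not v)) reversed-injective (rankings-unique k) ∈-rankings)

  -- By `swap-flips` one of two injective relabellings moves a ranking of the left cell into the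
  -- right one. Adjacent cells thus differ by a factor of at most 2, which is correlation at most
  -- 1/3.
  cells-swap : ∀ u v → cells u v ≤ cells u (not v) + cells u (not v)
  cells-swap u v = begin
    cells u v
      ≤⟨ ∑-mono (rankings k) pointwise ⟩
    ∑[ x ∈ rankings k ] (cell u (not v) (swap c d x) + cell u (not v) (swap a b (swap c d x)))
      ≡⟨ ∑-distrib-+ (rankings k) _ _ ⟩
    ∑[ x ∈ rankings k ] cell u (not v) (swap c d x) + ∑[ x ∈ rankings k ] cell u (not v) (swap a b (swap c d x))
      ≤⟨ +-mono-≤
           (∑-injective-≤ (swap c d) (cell u (not v)) (swap-injective c d) (rankings-unique k) ∈-rankings)
           (∑-injective-≤ (swap a b ∘ swap c d) (cell u (not v)) (swap-injective c d ∘ swap-injective a b)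
             (rankings-unique k) ∈-rankings) ⟩
    cells u (not v) + cells u (not v) ∎
    where
    open ≤-Reasoning
    carry : ∀ x y → FlipsSecond a b c d x y → cell u v x ≡ cell u (not v) y
    carry x y (eqz , eqw) = cong₂ _*_ (cong (same u) (sym eqz))
      (trans (sym (same-not-not v (w x))) (cong (same (not v)) (sym eqw)))
    pointwise : ∀ x → cell u v x ≤ cell u (not v) (swap c d x) + cell u (not v) (swap a b (swap c d x))
    pointwise x with swap-flips x a≢b c≢d c≢a c≢b
    ... | inj₁ fl = ≤-trans (≤-reflexive (carry x (swap c d x) fl)) (m≤m+n _ _)
    ... | inj₂ fl = ≤-trans (≤-reflexive (carry x (swap a b (swap c d x)) fl)) (m≤n+m _ _)

  cells-ff : cells false false ≡ p
  cells-ff = ≤-antisym (cells-reverse false false) (cells-reverse true true)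

  cells-ft : cells false true ≡ q
  cells-ft = ≤-antisym (cells-reverse false true) (cells-reverse true false)

  joint : ∀ u v → cells u v ≡ same u v * p + same u (not v) * q
  joint true  true  = sym (trans (+-identityʳ _) (+-identityʳ _))
  joint true  false = sym (+-identityʳ _)
  joint false true  = trans cells-ft (sym (+-identityʳ _))
  joint false false = trans cells-ff (sym (trans (+-identityʳ _) (+-identityʳ _)))

  -- The factor 2 of `cells-swap` is relaxed to the factor 3 that `two-point` admits.
  p≤3q : p ≤ 3 * q
  p≤3q = ≤-trans (cells-swap true true) (+-monoʳ-≤ q (m≤m+n q _))

  q≤3p : q ≤ 3 * p
  q≤3p = ≤-trans (cells-swap true false) (+-monoʳ-≤ p (m≤m+n p _))

  private
    same-total : ∀ t → same true t + same false t ≡ 1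
    same-total true  = refl
    same-total false = refl

  marginalˡ : ∀ u → ∑[ x ∈ rankings k ] same u (z x) ≡ p + q
  marginalˡ u = trans (∑-cong (rankings k) λ x → sym (trans (sym (*-distribˡ-+ (same u (z x)) _ _))
      (trans (cong (same u (z x) *_) (same-total (w x))) (*-identityʳ _))))
    (trans (∑-distrib-+ (rankings k) (cell u true) (cell u false)) (total u))
    where
    total : ∀ u → cells u true + cells u false ≡ p + q
    total true  = refl
    total false = trans (cong₂ _+_ cells-ft cells-ff) (+-comm q p)

  marginalʳ : ∀ v → ∑[ x ∈ rankings k ] same v (w x) ≡ p + q
  marginalʳ v = trans (∑-cong (rankings k) λ x → sym (trans (sym (*-distribʳ-+ (same v (w x)) (same true (z x)) (same false (z x))))
      (trans (cong (_* same v (w x)) (same-total (z x))) (*-identityˡ _))))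
    (trans (∑-distrib-+ (rankings k) (cell true v) (cell false v)) (total v))
    where
    total : ∀ v → cells true v + cells false v ≡ p + q
    total true  = cong (p +_) cells-ft
    total false = trans (cong (q +_) cells-ff) (+-comm q p)

  length-rankings≡2s : length (rankings k) ≡ (p + q) + (p + q)
  length-rankings≡2s = begin
    length (rankings k)                                            ≡⟨ *-identityʳ _ ⟨
    length (rankings k) * 1                                        ≡⟨ ∑-const (rankings k) 1 ⟨
    ∑[ x ∈ rankings k ] 1                                          ≡⟨ ∑-cong (rankings k) (λ x → same-total (z x)) ⟨
    ∑[ x ∈ rankings k ] (same true (z x) + same false (z x))       ≡⟨ ∑-distrib-+ (rankings k) _ _ ⟩
    ∑[ x ∈ rankings k ] same true (z x) + ∑[ x ∈ rankings k ] same false (z x) ≡⟨ cong₂ _+_ (marginalˡ true) (marginalˡ false) ⟩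
    (p + q) + (p + q)                                              ∎
    where open ≡-Reasoning

-- Boundaries and bad planes

∃? : {A : Set} {P : A → Set} {xs : List A} → (∀ x → x ∈ xs) → (∀ x → Dec (P x)) → Dec (∃ P)
∃? {xs = xs} complete P? = map′ Any.satisfied (λ (x , px) → lose (complete x) px) (any? P? xs)

≫-dec : (a : Fin k) (σ : Ranking k) (b : Fin k) → Dec (a ≫[ σ ] b)
≫-dec a σ b = map′ wrap unwrap (rank σ a F.<? rank σ b)

∃-indicator : {A : Set} {P : A → Set} (xs : List A) (complete : ∀ x → x ∈ xs) (P? : ∀ x → Dec (P x)) →
  (d : Dec (∃ P)) → indicator d ≤ ∑[ x ∈ xs ] indicator (P? x)
∃-indicator xs complete P? (no _)        = z≤n
∃-indicator xs complete P? (yes (x , p)) = begin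
  1                               ≡⟨ indicator-yes (P? x) p ⟨
  indicator (P? x)                ≤⟨ ∑-∈ (indicator ∘ P?) (complete x) ⟩
  ∑[ x ∈ xs ] indicator (P? x)    ∎
  where open ≤-Reasoning

module Entering {A : Set} {Q : A → Set} (Q? : ∀ x → Dec (Q x)) where

  enters? : ∀ x y → Dec (¬ Q x × Q y)
  enters? x y = ¬? (Q? x) ×-dec Q? y

  -- A directed quasi-metric: a path from outside `Q` to inside must enter at some step, which is
  -- the triangle inequality.
  enters : A → A → ℕ
  enters x y = indicator (enters? x y)

  enters-refl : ∀ x → enters x x ≡ 0
  enters-refl x = n≤0⇒n≡0 (indicator-mono (enters? x x) (no id) λ (¬q , q) → ¬q q)

  enters-triangle : ∀ x y w → enters x w ≤ enters x y + enters y w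
  enters-triangle x y w = cases (enters? x w) (Q? y)
    where
    cases : (e : Dec (¬ Q x × Q w)) → Dec (Q y) → indicator e ≤ enters x y + enters y w
    cases (no _)          _       = z≤n
    cases (yes (¬x , w∈)) (yes y∈) =
      ≤-trans (≤-reflexive (sym (indicator-yes (enters? x y) (¬x , y∈)))) (m≤m+n _ _)
    cases (yes (¬x , w∈)) (no ¬y) =
      ≤-trans (≤-reflexive (sym (indicator-yes (enters? y w) (¬y , w∈)))) (m≤n+m _ _)

module Social {n k} (f : SCF n k) where

  S : List (Ranking k)
  S = rankings k

  P : List (Profile n k)
  P = vecs S n

  N : ℕ
  N = length S

  Manipulation : Profile n k → Fin n → Ranking k → Set
  Manipulation σ i τ = f (σ [ i ]≔ τ) ≫[ lookup σ i ] f σ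

  Manipulable : Profile n k → Set
  Manipulable σ = ∃ λ i → ∃ λ τ → Manipulation σ i τ

  manipulable? : ∀ σ → Dec (Manipulable σ)
  manipulable? σ = ∃? ∈-allFin λ i → ∃? ∈-rankings λ τ → ≫-dec _ (lookup σ i) _

  #manip : ℕ
  #manip = ∑[ σ ∈ P ] indicator (manipulable? σ)

  plane : Profile n k → Fin n → Fin n → Ranking k → Ranking k → Profile n k
  plane σ i j x y = (σ [ i ]≔ x) [ j ]≔ y

  Bad : Fin n → Fin n → Profile n k → Set
  Bad i j σ = ∃ λ x → ∃ λ y → Manipulable (plane σ i j x y)

  bad? : ∀ i j σ → Dec (Bad i j σ)
  bad? i j σ = ∃? ∈-rankings λ x → ∃? ∈-rankings λ y → manipulable? (plane σ i j x y)

  -- A bad profile becomes manipulable after replacing two votes, and by `∑-resample` the union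
  -- bound over each replacement costs one factor `N`.
  #bad : ∀ i j → ∑[ σ ∈ P ] indicator (bad? i j σ) ≤ N * (N * #manip)
  #bad i j = begin
    ∑[ σ ∈ P ] indicator (bad? i j σ)
      ≤⟨ ∑-mono P (λ σ → ∃-indicator S ∈-rankings _ (bad? i j σ)) ⟩
    ∑[ σ ∈ P ] ∑[ x ∈ S ] indicator (row? (σ [ i ]≔ x))
      ≡⟨ ∑-resample S n i (indicator ∘ row?) ⟩
    N * ∑[ σ ∈ P ] indicator (row? σ)
      ≤⟨ *-monoʳ-≤ N (∑-mono P λ σ → ∃-indicator S ∈-rankings _ (row? σ)) ⟩
    N * ∑[ σ ∈ P ] ∑[ y ∈ S ] indicator (manipulable? (σ [ j ]≔ y))
      ≡⟨ cong (N *_) (∑-resample S n j _) ⟩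
    N * (N * #manip) ∎
    where
    open ≤-Reasoning
    row? : ∀ σ → Dec (∃ λ y → Manipulable (σ [ j ]≔ y))
    row? σ = ∃? ∈-rankings λ y → manipulable? (σ [ j ]≔ y)

  update-cross : ∀ (σ : Profile n k) {i j} → i ≢ j → ∀ x y → (σ [ j ]≔ y) [ i ]≔ x ≡ plane σ i j x y
  update-cross σ {i} {j} i≢j x y = Vecₚ.[]≔-commutes σ j i (i≢j ∘ sym)

  plane-unmanipulable : ∀ {i j σ} → i ≢ j → ¬ Bad i j σ → Unmanipulable (λ x y → f (plane σ i j x y))
  plane-unmanipulable {i} {j} {σ} i≢j ¬bad = first , second
    where
    first : ∀ x x' y → ¬ f (plane σ i j x' y) ≫[ x ] f (plane σ i j x y)
    first x x' y better = ¬bad (x , y , i , x' , subst₂ (λ π ρ → f π ≫[ ρ ] f (plane σ i j x y))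
      (sym (trans (cong (_[ i ]≔ x') (sym (update-cross σ i≢j x y)))
        (trans (Vecₚ.[]≔-idempotent (σ [ j ]≔ y) i) (update-cross σ i≢j x' y))))
      (sym (trans (Vecₚ.lookup∘update′ i≢j (σ [ i ]≔ x) y) (Vecₚ.lookup∘update i σ x)))
      better)
    second : ∀ x y y' → ¬ f (plane σ i j x y') ≫[ y ] f (plane σ i j x y)
    second x y y' better = ¬bad (x , y , j , y' , subst₂ (λ π ρ → f π ≫[ ρ ] f (plane σ i j x y))
      (sym (Vecₚ.[]≔-idempotent (σ [ i ]≔ x) j))
      (sym (Vecₚ.lookup∘update j (σ [ i ]≔ x) y))
      better)

  Attains : Fin n → Fin k → Profile n k → Set
  Attains i a σ = ∃ λ x → f (σ [ i ]≔ x) ≡ a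

  -- A property of the whole line through the profile in direction `i`: vote `i` itself has no
  -- influence on it, which is `boundary-line`.
  Boundary : Fin n → Fin k → Fin k → Profile n k → Set
  Boundary i a b σ = Attains i a σ × Attains i b σ

  boundary? : ∀ i a b σ → Dec (Boundary i a b σ)
  boundary? i a b σ = attains? a ×-dec attains? b
    where
    attains? : ∀ a → Dec (Attains i a σ)
    attains? a = ∃? ∈-rankings λ x → f (σ [ i ]≔ x) F.≟ a

  #boundary : Fin n → Fin k → Fin k → ℕ
  #boundary i a b = ∑[ σ ∈ P ] indicator (boundary? i a b σ)

  boundary-line : ∀ {i a b σ τ} → Boundary i a b (σ [ i ]≔ τ) → Boundary i a b σ
  boundary-line {i} {a} {b} {σ} (p , q) = move p , move q
    where
    move : ∀ {a} → Attains i a (σ [ i ]≔ _) → Attains i a σ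
    move (x , eq) = x , trans (cong f (sym (Vecₚ.[]≔-idempotent σ i))) eq

  attains⇒option₁ : ∀ {i j a σ} → i ≢ j → ∀ y → Attains i a (σ [ j ]≔ y) →
    Option (λ x y → f (plane σ i j x y)) y a
  attains⇒option₁ {σ = σ} i≢j y (x , eq) = x , trans (cong f (sym (update-cross σ i≢j x y))) eq

  option⇒attains₁ : ∀ {i j a σ} → i ≢ j → ∀ y → Option (λ x y → f (plane σ i j x y)) y a →
    Attains i a (σ [ j ]≔ y)
  option⇒attains₁ {σ = σ} i≢j y (x , eq) = x , trans (cong f (update-cross σ i≢j x y)) eq

  -- On a plane without manipulation `option-persists` runs backwards, from `τ` to the present vote
  -- `j`, and would put both `a` and `b` on the menu of voter `i` at `σ`.
  boundary-crossing : ∀ {i j a b σ τ} → i ≢ j → a ≢ b →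
    ¬ Boundary i a b σ → Boundary i a b (σ [ j ]≔ τ) →
    prefers a b (lookup σ j) ≡ prefers a b τ → Bad i j σ
  boundary-crossing {i} {j} {a} {b} {σ} {τ} i≢j a≢b out (pa , pb) eq =
    decidable-stable (bad? i j σ) λ ¬bad →
    let sp  = plane-unmanipulable i≢j ¬bad
        ag  = prefers-agree a≢b (sym eq)
        oa  = attains⇒option₁ i≢j τ pa
        ob  = attains⇒option₁ i≢j τ pb
        back : ∀ {c} → Option (λ x y → f (plane σ i j x y)) (lookup σ j) c → Attains i c σ
        back o = subst (Attains i _) (Vecₚ.[]≔-lookup σ j) (option⇒attains₁ i≢j (lookup σ j) o)
    in out (back (option-persists sp a≢b ag oa ob) ,
            back (option-persists sp (a≢b ∘ sym) (agree-sym ag) ob oa))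

  -- In the plane, the first boundary is a menu of voter `i` given vote `j`, the second a menu of
  -- voter `j` given vote `i`, both read at the same profile; `no-three-options` forbids this unless
  -- the plane is bad.
  boundaries-meet : ∀ {i j a b c d σ} → i ≢ j → a ≢ b → c ≢ d → c ≢ a → c ≢ b →
    Boundary i a b σ → Boundary j c d σ → Bad i j σ
  boundaries-meet {i} {j} {σ = σ} i≢j a≢b c≢d c≢a c≢b (pa , pb) (pc , pd) =
    decidable-stable (bad? i j σ) λ ¬bad →
    no-three-options (plane-unmanipulable i≢j ¬bad) a≢b c≢d c≢a c≢b
      (option₁ pa) (option₁ pb) (option₂ pc) (option₂ pd)
    where
    option₁ : ∀ {e} → Attains i e σ → Option (λ x y → f (plane σ i j x y)) (lookup σ j) e
    option₁ p = attains⇒option₁ i≢j (lookup σ j)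
      (subst (Attains i _) (sym (Vecₚ.[]≔-lookup σ j)) p)
    option₂ : ∀ {e} → Attains j e σ → Option (λ y x → f (plane σ i j x y)) (lookup σ i) e
    option₂ (y , eq) = y , trans (cong (λ π → f (π [ j ]≔ y)) (Vecₚ.[]≔-lookup σ i)) eq

-- Boundaries as approximate unions of fibres, and their intersection

module Fibres {n k} (f : SCF n k) (i : Fin n) {a b : Fin k} (a≢b : a ≢ b) (s : ℕ)
  (marginal : ∀ u → ∑[ x ∈ rankings k ] same u (prefers a b x) ≡ s) where
  open Social f

  private
    z : Ranking k → Bool
    z = prefers a b

    K : Ranking k → Ranking k → ℕ
    K x y = same (z x) (z y)

    B? : ∀ σ → Dec (Boundary i a b σ)
    B? = boundary? i a b

    open Entering B?

    open Telescope S K s (λ x → marginal (z x))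
      (λ y → trans (∑-cong S λ x → same-comm (z x) (z y)) (marginal (z y)))

    step-bound : ∀ l → steps n enters l ≤ s * (N * (N * #manip))
    step-bound l = begin
      ∑[ σ ∈ P ] ∑[ x ∈ S ] (K (lookup σ l) x * enters σ (σ [ l ]≔ x))
        ≤⟨ ∑-mono P (λ σ → ∑-mono S λ x → same-mono (z (lookup σ l)) (z x) λ eq →
             indicator-mono (enters? σ (σ [ l ]≔ x)) (bad? i l σ) (crosses σ x eq)) ⟩
      ∑[ σ ∈ P ] ∑[ x ∈ S ] (K (lookup σ l) x * indicator (bad? i l σ))
        ≡⟨ ∑-cong P (λ σ → trans (∑-*ʳ S (indicator (bad? i l σ)) (K (lookup σ l)))
             (cong (_* indicator (bad? i l σ)) (marginal (z (lookup σ l))))) ⟩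
      ∑[ σ ∈ P ] (s * indicator (bad? i l σ))
        ≡⟨ ∑-*ˡ P s _ ⟩
      s * ∑[ σ ∈ P ] indicator (bad? i l σ)
        ≤⟨ *-monoʳ-≤ s (#bad i l) ⟩
      s * (N * (N * #manip)) ∎
      where
      open ≤-Reasoning
      crosses : ∀ σ x → z (lookup σ l) ≡ z x →
        ¬ Boundary i a b σ × Boundary i a b (σ [ l ]≔ x) → Bad i l σ
      crosses σ x eq (out , inside) with i F.≟ l
      -- Changing vote `i` itself never crosses the boundary.
      ... | yes refl = contradiction (boundary-line {τ = x} inside) out
      ... | no i≢l   = boundary-crossing i≢l a≢b out inside eq

  -- For a profile off the boundary this is the number of boundary profiles in its fibre, for others
  -- it is zero. It measures how far the boundary is from being a union of fibres.
  leak : Profile n k → ℕ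
  leak σ = ∑[ π ∈ P ] (⨂ K σ π * enters σ π)

  leak-total : 0 < s → ∑ P leak ≤ s ^ n * (n * (N * (N * #manip)))
  leak-total 0<s = *-cancelˡ-≤ s {{>-nonZero 0<s}} (begin
    s * ∑ P leak
      ≤⟨ telescope n enters enters-refl enters-triangle ⟩
    s ^ n * ∑ (allFin n) (steps n enters)
      ≤⟨ *-monoʳ-≤ (s ^ n) (∑-mono (allFin n) step-bound) ⟩
    s ^ n * ∑[ l ∈ allFin n ] (s * (N * (N * #manip)))
      ≡⟨ cong (s ^ n *_) (trans (∑-const (allFin n) _) (cong (_* (s * (N * (N * #manip)))) (Listₚ.length-tabulate {n = n} id))) ⟩
    s ^ n * (n * (s * (N * (N * #manip))))
      ≡⟨ rearrange s (s ^ n) n (N * (N * #manip)) ⟩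
    s * (s ^ n * (n * (N * (N * #manip)))) ∎)
    where
    open ≤-Reasoning
    rearrange : ∀ s t n β → t * (n * (s * β)) ≡ s * (t * (n * β))
    rearrange = solve-∀

  private
    δ : Bool → Ranking k → ℕ
    δ u x = same u (z x)

  -- The number of boundary profiles in the fibre over `y`, left unnormalised; the size `s ^ n` of a
  -- fibre is therefore the constant passed to `reverse-hypercontractive`.
  density : Vec Bool n → ℕ
  density y = ∑[ σ ∈ P ] (⨂ δ y σ * indicator (B? σ))

  density-total : ∑ (vecs bools n) density ≡ #boundary i a b
  density-total = begin
    ∑[ y ∈ vecs bools n ] ∑[ σ ∈ P ] (⨂ δ y σ * indicator (B? σ)) ≡⟨ ∑-swap (vecs bools n) P _ ⟩
    ∑[ σ ∈ P ] ∑[ y ∈ vecs bools n ] (⨂ δ y σ * indicator (B? σ)) ≡⟨ ∑-cong P (λ σ → trans (∑-*ʳ (vecs bools n) (indicator (B? σ)) (λ y → ⨂ δ y σ)) (cong (_* indicator (B? σ)) (one σ))) ⟩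
    ∑[ σ ∈ P ] (1 * indicator (B? σ))                              ≡⟨ ∑-cong P (λ σ → *-identityˡ _) ⟩
    #boundary i a b                                                ∎
    where
    open ≡-Reasoning
    δ-total : ∀ x → ∑ bools (flip δ x) ≡ 1
    δ-total x with z x
    ... | true  = refl
    ... | false = refl
    one : ∀ σ → ∑[ y ∈ vecs bools n ] ⨂ δ y σ ≡ 1
    one σ = trans (∑-cong (vecs bools n) λ y → ⨂-flip δ y σ)
      (trans (⨂-rowsum (flip δ) bools δ-total σ) (^-zeroˡ n))

  density-≤ : ∀ y → density y ≤ s ^ n
  density-≤ y = begin
    ∑[ σ ∈ P ] (⨂ δ y σ * indicator (B? σ)) ≤⟨ ∑-mono P (λ σ → *-monoʳ-≤ (⨂ δ y σ) (indicator-≤1 (B? σ))) ⟩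
    ∑[ σ ∈ P ] (⨂ δ y σ * 1)                ≡⟨ ∑-cong P (λ σ → *-identityʳ _) ⟩
    ∑[ σ ∈ P ] ⨂ δ y σ                      ≡⟨ ⨂-rowsum δ S marginal y ⟩
    s ^ n                                   ∎
    where open ≤-Reasoning

  -- From a profile off the boundary, every boundary profile of the same fibre is an entry.
  density-≤-leak : ∀ σ → ¬ Boundary i a b σ → density (Vec.map z σ) ≤ leak σ
  density-≤-leak σ out = ∑-mono P λ π → *-mono-≤ (≤-reflexive (⨂-map δ z σ π))
    (indicator-mono (B? π) (enters? σ π) (out ,_))

module Meeting {n k} (f : SCF n k) {i j : Fin n} {a b c d : Fin k} (i≢j : i ≢ j)
  (a≢b : a ≢ b) (c≢d : c ≢ d) (c≢a : c ≢ a) (c≢b : c ≢ b) where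
  open Social f
  open Joint a≢b c≢d c≢a c≢b

  private
    s : ℕ
    s = p + q

    module L = Fibres f i a≢b s marginalˡ
    module R = Fibres f j c≢d s marginalʳ
    open Correlated S (prefers a b) (prefers c d) p q p≤3q q≤3p joint

    β : ℕ
    β = N * (N * #manip)

    0<s : 0 < N → 0 < s
    0<s 0<N with s in eq
    ... | suc _ = z<s
    ... | zero  = subst (0 <_) (trans length-rankings≡2s (cong₂ _+_ eq eq)) 0<N

    both? : ∀ σ → Dec (Boundary i a b σ × Boundary j c d σ)
    both? σ = boundary? i a b σ ×-dec boundary? j c d σ

    -- A profile on both boundaries is charged the full fibre sizes. Otherwise one of the two
    -- densities is at most the leak of its boundary at `σ`, and the other is at most a fibre.
    pointwise : ∀ σ → L.density (Vec.map (prefers a b) σ) * R.density (Vec.map (prefers c d) σ) ≤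
      s ^ n * s ^ n * indicator (both? σ) + s ^ n * (L.leak σ + R.leak σ)
    pointwise σ = cases (boundary? i a b σ) (boundary? j c d σ)
      where
      y = Vec.map (prefers a b) σ
      y' = Vec.map (prefers c d) σ
      cases : Dec (Boundary i a b σ) → Dec (Boundary j c d σ) → _
      cases (yes B) (yes B') = ≤-trans (*-mono-≤ (L.density-≤ y) (R.density-≤ y'))
        (≤-trans (≤-reflexive (sym (trans (cong (s ^ n * s ^ n *_) (indicator-yes (both? σ) (B , B'))) (*-identityʳ _)))) (m≤m+n _ _))
      cases (no ¬B) _ = ≤-trans (*-mono-≤ (L.density-≤-leak σ ¬B) (R.density-≤ y'))
        (≤-trans (≤-reflexive (*-comm (L.leak σ) (s ^ n))) (≤-trans (*-monoʳ-≤ (s ^ n) (m≤m+n _ _)) (m≤n+m _ _)))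
      cases (yes _) (no ¬B') = ≤-trans (*-mono-≤ (L.density-≤ y) (R.density-≤-leak σ ¬B'))
        (≤-trans (*-monoʳ-≤ (s ^ n) (m≤n+m _ _)) (m≤n+m _ _))

    correlation-≤ : 0 < N → correlation L.density R.density ≤ s ^ n * s ^ n * ((1 + 2 * n) * β)
    correlation-≤ 0<N = begin
      correlation L.density R.density
        ≤⟨ ∑-mono P pointwise ⟩
      ∑[ σ ∈ P ] (s ^ n * s ^ n * indicator (both? σ) + s ^ n * (L.leak σ + R.leak σ))
        ≡⟨ trans (∑-distrib-+ P _ _) (cong₂ _+_ (∑-*ˡ P (s ^ n * s ^ n) _) (trans (∑-*ˡ P (s ^ n) _) (cong (s ^ n *_) (∑-distrib-+ P _ _)))) ⟩
      s ^ n * s ^ n * ∑[ σ ∈ P ] indicator (both? σ) + s ^ n * (∑ P L.leak + ∑ P R.leak)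
        ≤⟨ +-mono-≤
             (*-monoʳ-≤ (s ^ n * s ^ n) (≤-trans (∑-mono P λ σ → indicator-mono (both? σ) (bad? i j σ) λ (B , B') → boundaries-meet i≢j a≢b c≢d c≢a c≢b B B') (#bad i j)))
             (*-monoʳ-≤ (s ^ n) (+-mono-≤ (L.leak-total (0<s 0<N)) (R.leak-total (0<s 0<N)))) ⟩
      s ^ n * s ^ n * β + s ^ n * (s ^ n * (n * β) + s ^ n * (n * β))
        ≡⟨ rearrange (s ^ n) n β ⟩
      s ^ n * s ^ n * ((1 + 2 * n) * β) ∎
      where
      open ≤-Reasoning
      rearrange : ∀ t n β → t * t * β + t * (t * (n * β) + t * (n * β)) ≡ t * t * ((1 + 2 * n) * β)
      rearrange = solve-∀

  -- The lower bound on the correlation of the two densities is confronted with `correlation-≤`. The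
  -- powers fit because `N` is 2s: 8^n times s^(3n) is N^(3n).
  meeting : 0 < N →
    #boundary i a b * #boundary i a b * (#boundary j c d * #boundary j c d) ≤
    N ^ n * N ^ n * N ^ n * ((1 + 2 * n) * (N * (N * #manip)))
  meeting 0<N = *-cancelˡ-≤ (s ^ n) {{m^n≢0 s n {{>-nonZero (0<s 0<N)}}}} (begin
    s ^ n * (#boundary i a b * #boundary i a b * (#boundary j c d * #boundary j c d))
      ≡⟨ cong₂ (λ x y → s ^ n * (x * x * (y * y))) L.density-total R.density-total ⟨
    s ^ n * (∑ (vecs bools n) L.density * ∑ (vecs bools n) L.density * (∑ (vecs bools n) R.density * ∑ (vecs bools n) R.density))
      ≤⟨ reverse-hypercontractive n L.density R.density L.density-≤ R.density-≤ ⟩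
    8 ^ n * (s ^ n * s ^ n) * correlation L.density R.density
      ≤⟨ *-monoʳ-≤ (8 ^ n * (s ^ n * s ^ n)) (correlation-≤ 0<N) ⟩
    8 ^ n * (s ^ n * s ^ n) * (s ^ n * s ^ n * ((1 + 2 * n) * β))
      ≡⟨ cong (λ e → e * (s ^ n * s ^ n) * (s ^ n * s ^ n * ((1 + 2 * n) * β))) 8^n ⟩
    2 ^ n * (2 ^ n * 2 ^ n) * (s ^ n * s ^ n) * (s ^ n * s ^ n * ((1 + 2 * n) * β))
      ≡⟨ rearrange (2 ^ n) (s ^ n) ((1 + 2 * n) * β) ⟩
    s ^ n * (2 ^ n * s ^ n * (2 ^ n * s ^ n) * (2 ^ n * s ^ n) * ((1 + 2 * n) * β))
      ≡⟨ cong (λ T → s ^ n * (T * T * T * ((1 + 2 * n) * β))) N^n ⟨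
    s ^ n * (N ^ n * N ^ n * N ^ n * ((1 + 2 * n) * β)) ∎)
    where
    open ≤-Reasoning
    8^n : 8 ^ n ≡ 2 ^ n * (2 ^ n * 2 ^ n)
    8^n = trans (^-distribʳ-* n 2 4) (cong (2 ^ n *_) (^-distribʳ-* n 2 2))
    N^n : N ^ n ≡ 2 ^ n * s ^ n
    N^n = trans (cong (_^ n) (trans length-rankings≡2s (cong (s +_) (sym (+-identityʳ s))))) (^-distribʳ-* n 2 s)
    rearrange : ∀ t s e → t * (t * t) * (s * s) * (s * s * e) ≡ s * (t * s * (t * s) * (t * s) * e)
    rearrange = solve-∀

-- Two large boundaries of different voters

module Boundaries {n k} (f : SCF n k) (num den : ℕ) (0<num : 0 < num)
  (far : ∀ g → NonManip g → num * length (rankings k) ^ n ≤ den * ∑[ σ ∈ vecs (rankings k) n ] indicator (¬? (f σ F.≟ g σ)))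
  (0<N : 0 < length (rankings k)) where
  open Social f

  T : ℕ
  T = N ^ n

  private
    instance
      N≢0 : NonZero N
      N≢0 = >-nonZero 0<N
      T≢0 : NonZero T
      T≢0 = m^n≢0 N n

    #P : length P ≡ T
    #P = length-vecs S n

    0<numT : 0 < num * T
    0<numT = >-nonZero⁻¹ (num * T) {{m*n≢0 num T {{>-nonZero 0<num}}}}

    #differ : SCF n k → ℕ
    #differ g = ∑[ σ ∈ P ] indicator (¬? (f σ F.≟ g σ))

    Triple : Set
    Triple = Fin n × Fin k × Fin k

    #∂ : Triple → ℕ
    #∂ (l , u , v) = #boundary l u v

    pairs : List (Fin k × Fin k)
    pairs = cartesianProductWith _,_ (allFin k) (allFin k)

    triples : List Triple
    triples = cartesianProductWith _,_ (allFin n) pairs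

    length-triples : length triples ≡ n * (k * k)
    length-triples = trans (length-product _,_ (allFin n) pairs) (cong₂ _*_ (Listₚ.length-tabulate {n = n} id)
      (trans (length-product _,_ (allFin k) (allFin k)) (cong₂ _*_ (Listₚ.length-tabulate {n = k} id) (Listₚ.length-tabulate {n = k} id))))

  Large : Fin n → Fin k → Fin k → Set
  Large l u v = num * T ≤ den * (n * (k * k * k)) * #boundary l u v

  large-swap : ∀ {l u v} → Large l u v → Large l v u
  large-swap {l} {u} {v} le = ≤-trans le (*-monoʳ-≤ (den * (n * (k * k * k)))
    (∑-mono P λ σ → indicator-mono (boundary? l u v σ) (boundary? l v u σ) (λ (p , q) → q , p)))

  private
    -- Some triple has at least the average weight, and there are n k² triples. This weight is
    -- positive because `num * T` is, so the triple satisfies `R`.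
    extract : ∀ {R : Triple → Set} (R? : ∀ t → Dec (R t)) →
      num * T ≤ den * k * ∑[ t ∈ triples ] (indicator (R? t) * #∂ t) →
      ∃ λ l → ∃ λ u → ∃ λ v → R (l , u , v) × Large l u v
    extract {R} R? le = finish (∃-large triples weight 0<weights)
      where
      weight : Triple → ℕ
      weight t = indicator (R? t) * #∂ t
      0<weights : 0 < ∑ triples weight
      0<weights = n≢0⇒n>0 λ eq → <⇒≱ 0<numT
        (subst (num * T ≤_) (trans (cong (den * k *_) eq) (*-zeroʳ (den * k))) le)
      finish : _ → _
      finish (t@(l , u , v) , large) = l , u , v , holds (R? t) bound
        where
        bound : num * T ≤ den * (n * (k * k * k)) * (indicator (R? t) * #∂ t)
        bound = begin
          num * T                                          ≤⟨ le ⟩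
          den * k * ∑ triples weight                       ≤⟨ *-monoʳ-≤ (den * k) large ⟩
          den * k * (length triples * weight t)            ≡⟨ cong (λ L → den * k * (L * weight t)) length-triples ⟩
          den * k * (n * (k * k) * weight t)               ≡⟨ rearrange den k n (weight t) ⟩
          den * (n * (k * k * k)) * weight t               ∎
          where
          open ≤-Reasoning
          rearrange : ∀ d k n w → d * k * (n * (k * k) * w) ≡ d * (n * (k * k * k)) * w
          rearrange = solve-∀
        holds : (r : Dec (R t)) → num * T ≤ den * (n * (k * k * k)) * (indicator r * #∂ t) → R t × Large l u v
        holds (yes r) le' = r , subst (λ w → num * T ≤ den * (n * (k * k * k)) * w) (*-identityˡ (#∂ t)) le'
        holds (no _)  le' = contradiction (subst (num * T ≤_) (*-zeroʳ (den * (n * (k * k * k)))) le') (<⇒≱ 0<numT)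

    -- A jump of voter `l` from outcome u to v exhibits both on the line, so its starting point lies
    -- on the boundary for (u, v), whichever of the `N` new votes caused it.
    jumps : ∀ {R : Fin k → Fin k → Set} (R? : ∀ u v → Dec (R u v)) l →
      ∑[ σ ∈ P ] ∑[ x ∈ S ] indicator (R? (f σ) (f (σ [ l ]≔ x))) ≤
      N * ∑[ (u , v) ∈ pairs ] (indicator (R? u v) * #boundary l u v)
    jumps {R} R? l = begin
      ∑[ σ ∈ P ] ∑[ x ∈ S ] indicator (R? (f σ) (f (σ [ l ]≔ x)))
        ≤⟨ ∑-mono P (λ σ → ∑-mono S λ x → crosses σ x) ⟩
      ∑[ σ ∈ P ] ∑[ x ∈ S ] ∑[ (u , v) ∈ pairs ] (indicator (R? u v) * indicator (boundary? l u v σ))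
        ≡⟨ trans (∑-cong P λ σ → ∑-const S _) (∑-*ˡ P N _) ⟩
      N * ∑[ σ ∈ P ] ∑[ (u , v) ∈ pairs ] (indicator (R? u v) * indicator (boundary? l u v σ))
        ≡⟨ cong (N *_) (trans (∑-swap P pairs _) (∑-cong pairs λ (u , v) → ∑-*ˡ P (indicator (R? u v)) _)) ⟩
      N * ∑[ (u , v) ∈ pairs ] (indicator (R? u v) * #boundary l u v) ∎
      where
      open ≤-Reasoning
      term : Profile n k → Fin k × Fin k → ℕ
      term σ (u , v) = indicator (R? u v) * indicator (boundary? l u v σ)
      crosses : ∀ σ x → indicator (R? (f σ) (f (σ [ l ]≔ x))) ≤ ∑ pairs (term σ)
      crosses σ x = begin
        indicator (R? u v)                 ≡⟨ *-identityʳ _ ⟨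
        indicator (R? u v) * 1             ≡⟨ cong (indicator (R? u v) *_) (indicator-yes (boundary? l u v σ) on-boundary) ⟨
        term σ (u , v)                     ≤⟨ ∑-∈ (term σ) (∈-cartesianProductWith⁺ _,_ (∈-allFin u) (∈-allFin v)) ⟩
        ∑ pairs (term σ)                   ∎
        where
        u = f σ
        v = f (σ [ l ]≔ x)
        on-boundary : Boundary l u v σ
        on-boundary = (lookup σ l , cong f (Vecₚ.[]≔-lookup σ l)) , (x , refl)

    telescope-uniform : (d : Profile n k → Profile n k → ℕ) → (∀ σ → d σ σ ≡ 0) →
      (∀ σ π ρ → d σ ρ ≤ d σ π + d π ρ) →
      N * ∑[ σ ∈ P ] ∑[ π ∈ P ] d σ π ≤ T * ∑[ l ∈ allFin n ] ∑[ σ ∈ P ] ∑[ x ∈ S ] d σ (σ [ l ]≔ x)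
    telescope-uniform d d-refl tri = subst₂ (λ a b → N * a ≤ T * b)
      (∑-cong P λ σ → ∑-cong P λ π → trans (cong (_* d σ π) (all-ones σ π)) (*-identityˡ _))
      (∑-cong (allFin n) λ l → ∑-cong P λ σ → ∑-cong S λ x → *-identityˡ _)
      (Telescope.telescope S (λ _ _ → 1) N const-sum const-sum n d d-refl tri)
      where
      const-sum : Ranking k → ∑[ x ∈ S ] 1 ≡ N
      const-sum _ = trans (∑-const S 1) (*-identityʳ N)
      all-ones : ∀ {n} (σ π : Profile n k) → ⨂ (λ _ _ → 1) σ π ≡ 1
      all-ones []      []      = refl
      all-ones (_ ∷ σ) (_ ∷ π) = trans (*-identityˡ _) (all-ones σ π)

    module Separate {Q : Fin k → Set} (Q? : ∀ u → Dec (Q u)) where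
      #in #out : ℕ
      #in  = ∑[ σ ∈ P ] indicator (Q? (f σ))
      #out = ∑[ σ ∈ P ] indicator (¬? (Q? (f σ)))

      open Entering (λ σ → Q? (f σ))

      R? : ∀ (t : Triple) → let (_ , u , v) = t in Dec (¬ Q u × Q v)
      R? (_ , u , v) = ¬? (Q? u) ×-dec Q? v

      entering-total : ∑[ σ ∈ P ] ∑[ π ∈ P ] enters σ π ≡ #out * #in
      entering-total = begin
        ∑[ σ ∈ P ] ∑[ π ∈ P ] enters σ π
          ≡⟨ ∑-cong P (λ σ → ∑-cong P λ π → indicator-× (¬? (Q? (f σ))) (Q? (f π))) ⟩
        ∑[ σ ∈ P ] ∑[ π ∈ P ] (indicator (¬? (Q? (f σ))) * indicator (Q? (f π)))
          ≡⟨ ∑-cong P (λ σ → ∑-*ˡ P (indicator (¬? (Q? (f σ)))) _) ⟩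
        ∑[ σ ∈ P ] (indicator (¬? (Q? (f σ))) * #in)
          ≡⟨ ∑-*ʳ P #in _ ⟩
        #out * #in ∎
        where
        open ≡-Reasoning
        indicator-× : ∀ {X Y : Set} (x : Dec X) (y : Dec Y) → indicator (x ×-dec y) ≡ indicator x * indicator y
        indicator-× (yes _) (yes _) = refl
        indicator-× (yes _) (no _)  = refl
        indicator-× (no _)  _       = refl

      -- The left side counts the pairs of profiles that lead from outside `Q` into it. The path
      -- between them enters `Q` by the change of a single vote, and such a step starts on a
      -- boundary between an outcome outside and one inside.
      isoperimetry : #out * #in ≤ T * ∑[ t ∈ triples ] (indicator (R? t) * #∂ t)
      isoperimetry = *-cancelˡ-≤ N (begin
        N * (#out * #in)
          ≡⟨ cong (N *_) entering-total ⟨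
        N * ∑[ σ ∈ P ] ∑[ π ∈ P ] enters σ π
          ≤⟨ telescope-uniform enters enters-refl enters-triangle ⟩
        T * ∑[ l ∈ allFin n ] ∑[ σ ∈ P ] ∑[ x ∈ S ] enters σ (σ [ l ]≔ x)
          ≤⟨ *-monoʳ-≤ T (∑-mono (allFin n) (jumps (λ u v → ¬? (Q? u) ×-dec Q? v))) ⟩
        T * ∑[ l ∈ allFin n ] (N * ∑[ (u , v) ∈ pairs ] (indicator (R? (l , u , v)) * #boundary l u v))
          ≡⟨ cong (T *_) (trans (∑-*ˡ (allFin n) N _) (cong (N *_) (sym (∑-product _,_ (allFin n) pairs _)))) ⟩
        T * (N * W)
          ≡⟨ rearrange T N W ⟩
        N * (T * W) ∎)
        where
        open ≤-Reasoning
        W = ∑[ t ∈ triples ] (indicator (R? t) * #∂ t)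
        rearrange : ∀ t n w → t * (n * w) ≡ n * (t * w)
        rearrange = solve-∀

      separate : num * T ≤ den * #out → T ≤ k * #in →
        ∃ λ l → ∃ λ u → ∃ λ v → (¬ Q u × Q v) × Large l u v
      separate out-large in-large = extract R? (*-cancelˡ-≤ T (begin
        T * (num * T)         ≡⟨ *-comm T _ ⟩
        num * T * T           ≤⟨ *-mono-≤ out-large in-large ⟩
        den * #out * (k * #in) ≡⟨ rearrange₁ den #out k #in ⟩
        den * k * (#out * #in) ≤⟨ *-monoʳ-≤ (den * k) isoperimetry ⟩
        den * k * (T * W)     ≡⟨ rearrange₂ den k T W ⟩
        T * (den * k * W)     ∎))
        where
        open ≤-Reasoning
        W = ∑[ t ∈ triples ] (indicator (R? t) * #∂ t)
        rearrange₁ : ∀ d o k i → d * o * (k * i) ≡ d * k * (o * i)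
        rearrange₁ = solve-∀
        rearrange₂ : ∀ d k t w → d * k * (t * w) ≡ t * (d * k * w)
        rearrange₂ = solve-∀

  -- For each π the function `frozen π` depends on vote `i` alone, hence is far from `f`. Averaged
  -- over π, this says that redrawing all votes except `i` often changes the outcome, so some voter
  -- other than `i` often changes it alone.
  second-coordinate : 0 < k → (i : Fin n) → ∃ λ l → ∃ λ u → ∃ λ v → (l ≢ i × u ≢ v) × Large l u v
  -- No popularity factor 1/k is lost here; it is inserted to reach the common threshold `Large`.
  second-coordinate 0<k i = extract R? (≤-trans num*T≤ (*-monoˡ-≤ W (m≤m*n den k {{>-nonZero 0<k}})))
    where
    R? : ∀ (t : Triple) → let (l , u , v) = t in Dec (l ≢ i × u ≢ v)
    R? (l , u , v) = ¬? (l F.≟ i) ×-dec ¬? (u F.≟ v)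

    W : ℕ
    W = ∑[ t ∈ triples ] (indicator (R? t) * #∂ t)

    frozen : Profile n k → SCF n k
    frozen π σ = f (π [ i ]≔ lookup σ i)

    differ? : ∀ σ π → Dec (f σ ≢ f π)
    differ? σ π = ¬? (f σ F.≟ f π)

    -- Comparing whole lines in direction i yields a pseudometric blind to coordinate i.
    d : Profile n k → Profile n k → ℕ
    d σ π = ∑[ x ∈ S ] indicator (differ? (σ [ i ]≔ x) (π [ i ]≔ x))

    d-refl : ∀ σ → d σ σ ≡ 0
    d-refl σ = n≤0⇒n≡0 (≤-trans
      (∑-mono S λ x → indicator-mono (differ? (σ [ i ]≔ x) (σ [ i ]≔ x)) (no id) λ ne → ne refl)
      (≤-reflexive (trans (∑-const S 0) (*-zeroʳ N))))

    d-triangle : ∀ σ π ρ → d σ ρ ≤ d σ π + d π ρ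
    d-triangle σ π ρ = ≤-trans
      (∑-mono S λ x → differ-triangle (σ [ i ]≔ x) (π [ i ]≔ x) (ρ [ i ]≔ x))
      (≤-reflexive (∑-distrib-+ S _ _))
      where
      differ-triangle : ∀ σ π ρ → indicator (differ? σ ρ) ≤ indicator (differ? σ π) + indicator (differ? π ρ)
      differ-triangle σ π ρ = cases (f σ F.≟ f π)
        where
        cases : Dec (f σ ≡ f π) → _
        cases (yes eq) = ≤-trans (indicator-mono (differ? σ ρ) (differ? π ρ) (λ ne → ne ∘ trans eq)) (m≤n+m _ _)
        cases (no ne)  = ≤-trans (indicator-mono (differ? σ ρ) (differ? σ π) (λ _ → ne)) (m≤m+n _ _)

    -- Writing `x` into `σ` gives a uniform profile whose vote `i` is the very `x` written into `π`:
    -- this compares `f` with `frozen π`.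
    d-total : ∑[ σ ∈ P ] ∑[ π ∈ P ] d σ π ≡ N * ∑[ π ∈ P ] #differ (frozen π)
    d-total = begin
      ∑[ σ ∈ P ] ∑[ π ∈ P ] d σ π  ≡⟨ ∑-swap P P d ⟩
      ∑[ π ∈ P ] ∑[ σ ∈ P ] d σ π  ≡⟨ ∑-cong P (λ π → trans
        (∑-cong P λ σ → ∑-cong S λ x → cong (λ y → indicator (differ? (σ [ i ]≔ x) (π [ i ]≔ y))) (sym (Vecₚ.lookup∘update i σ x)))
        (∑-resample S n i (λ σ → indicator (¬? (f σ F.≟ frozen π σ))))) ⟩
      ∑[ π ∈ P ] (N * #differ (frozen π)) ≡⟨ ∑-*ˡ P N _ ⟩
      N * ∑[ π ∈ P ] #differ (frozen π)   ∎
      where open ≡-Reasoning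

    step : ∀ l → ∑[ σ ∈ P ] ∑[ x ∈ S ] d σ (σ [ l ]≔ x) ≤
      N * (N * ∑[ (u , v) ∈ pairs ] (indicator (R? (l , u , v)) * #boundary l u v))
    step l = begin
      ∑[ σ ∈ P ] ∑[ x ∈ S ] d σ (σ [ l ]≔ x)
        ≤⟨ ∑-mono P (λ σ → ∑-mono S λ x → ∑-mono S λ y → away σ x y) ⟩
      ∑[ σ ∈ P ] ∑[ x ∈ S ] ∑[ y ∈ S ] moves x (σ [ i ]≔ y)
        ≡⟨ ∑-swap P S _ ⟩
      ∑[ x ∈ S ] ∑[ σ ∈ P ] ∑[ y ∈ S ] moves x (σ [ i ]≔ y)
        ≡⟨ ∑-cong S (λ x → ∑-resample S n i (moves x)) ⟩
      ∑[ x ∈ S ] (N * ∑[ σ ∈ P ] moves x σ)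
        ≡⟨ trans (∑-*ˡ S N _) (cong (N *_) (∑-swap S P _)) ⟩
      N * ∑[ σ ∈ P ] ∑[ x ∈ S ] moves x σ
        ≤⟨ *-monoʳ-≤ N (jumps (λ u v → ¬? (l F.≟ i) ×-dec ¬? (u F.≟ v)) l) ⟩
      N * (N * ∑[ (u , v) ∈ pairs ] (indicator (R? (l , u , v)) * #boundary l u v)) ∎
      where
      open ≤-Reasoning
      moves? : ∀ x σ → Dec (l ≢ i × f σ ≢ f (σ [ l ]≔ x))
      moves? x σ = ¬? (l F.≟ i) ×-dec ¬? (f σ F.≟ f (σ [ l ]≔ x))
      moves : Ranking k → Profile n k → ℕ
      moves x σ = indicator (moves? x σ)
      away : ∀ σ x y → indicator (differ? (σ [ i ]≔ y) ((σ [ l ]≔ x) [ i ]≔ y)) ≤ moves x (σ [ i ]≔ y)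
      away σ x y = indicator-mono (differ? _ _) (moves? x (σ [ i ]≔ y)) λ ne →
        l≢i ne , λ eq → ne (trans eq (cong f (Vecₚ.[]≔-commutes σ i l (l≢i ne ∘ sym))))
        where
        l≢i : f (σ [ i ]≔ y) ≢ f ((σ [ l ]≔ x) [ i ]≔ y) → l ≢ i
        l≢i ne refl = ne (cong f (sym (Vecₚ.[]≔-idempotent σ i)))

    num*T≤ : num * T ≤ den * W
    num*T≤ = *-cancelˡ-≤ T (begin
      T * (num * T)                            ≡⟨ cong (_* (num * T)) #P ⟨
      length P * (num * T)                     ≡⟨ ∑-const P _ ⟨
      ∑[ π ∈ P ] (num * T)                     ≤⟨ ∑-mono P (λ π → far (frozen π) (inj₁ (i , λ σ σ' eq → cong (λ x → f (π [ i ]≔ x)) eq))) ⟩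
      ∑[ π ∈ P ] (den * #differ (frozen π))    ≡⟨ ∑-*ˡ P den _ ⟩
      den * ∑[ π ∈ P ] #differ (frozen π)      ≤⟨ *-monoʳ-≤ den averaged ⟩
      den * (T * W)                            ≡⟨ rearrange den T W ⟩
      T * (den * W)                            ∎)
      where
      open ≤-Reasoning
      rearrange : ∀ d t w → d * (t * w) ≡ t * (d * w)
      rearrange = solve-∀
      rearrange₂ : ∀ t n w → t * (n * (n * w)) ≡ n * (n * (t * w))
      rearrange₂ = solve-∀
      averaged : ∑[ π ∈ P ] #differ (frozen π) ≤ T * W
      averaged = *-cancelˡ-≤ N (*-cancelˡ-≤ N (begin
        N * (N * ∑[ π ∈ P ] #differ (frozen π))                       ≡⟨ cong (N *_) d-total ⟨
        N * ∑[ σ ∈ P ] ∑[ π ∈ P ] d σ π                               ≤⟨ telescope-uniform d d-refl d-triangle ⟩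
        T * ∑[ l ∈ allFin n ] ∑[ σ ∈ P ] ∑[ x ∈ S ] d σ (σ [ l ]≔ x) ≤⟨ *-monoʳ-≤ T (∑-mono (allFin n) step) ⟩
        T * ∑[ l ∈ allFin n ] (N * (N * ∑[ (u , v) ∈ pairs ] (indicator (R? (l , u , v)) * #boundary l u v)))
          ≡⟨ cong (T *_) (trans (∑-*ˡ (allFin n) N _) (cong (N *_) (trans (∑-*ˡ (allFin n) N _) (cong (N *_) (sym (∑-product _,_ (allFin n) pairs _)))))) ⟩
        T * (N * (N * W))                                             ≡⟨ rearrange₂ T N W ⟩
        N * (N * (T * W))                                             ∎))

  popular : ∃ λ u → T ≤ k * ∑[ σ ∈ P ] indicator (f σ F.≟ u)
  popular = finish (∃-large (allFin k) votes (subst (0 <_) (sym votes-total) (>-nonZero⁻¹ T)))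
    where
    votes : Fin k → ℕ
    votes u = ∑[ σ ∈ P ] indicator (f σ F.≟ u)
    kronecker : ∀ {k} (w : Fin k) → ∑[ u ∈ allFin k ] indicator (w F.≟ u) ≡ 1
    kronecker {suc k} zero = cong suc (trans (∑-tabulate-suc k (λ u → indicator (zero F.≟ u))) (trans (∑-const (allFin k) 0) (*-zeroʳ (length (allFin k)))))
    kronecker {suc k} (suc w) = trans (∑-tabulate-suc k (λ u → indicator (suc w F.≟ u))) (trans (∑-cong (allFin k) λ u → shift w u) (kronecker w))
      where
      shift : ∀ {k} (w u : Fin k) → indicator (suc w F.≟ suc u) ≡ indicator (w F.≟ u)
      shift w u with w F.≟ u
      ... | yes _ = refl
      ... | no _  = refl
    votes-total : ∑ (allFin k) votes ≡ T
    votes-total = trans (∑-swap (allFin k) P _) (trans (∑-cong P λ σ → kronecker (f σ))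
      (trans (∑-const P 1) (trans (*-identityʳ (length P)) #P)))
    finish : _ → _
    finish (u , le) = u , subst₂ (λ a b → a ≤ b * votes u) votes-total (Listₚ.length-tabulate {n = k} id) le

  record TwoBoundaries : Set where
    constructor boundaries
    field
      {i j}     : Fin n
      {a b c d} : Fin k
      i≢j       : i ≢ j
      a≢b       : a ≢ b
      c≢d       : c ≢ d
      c≢a       : c ≢ a
      c≢b       : c ≢ b
      large₁    : Large i a b
      large₂    : Large j c d

  private
    module Second {a b : Fin k} (b≢a : b ≢ a) (0<k : 0 < k)
      {l₁ : Fin n} (large₁ : Large l₁ b a) where

      Q : Fin k → Set
      Q u = u ≡ b ⊎ u ≡ a

      Q? : ∀ u → Dec (Q u)
      Q? u = (u F.≟ b) ⊎-dec (u F.≟ a)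

      clip : ∀ u → Dec (Q u) → Fin k
      clip u (yes _) = u
      clip u (no _)  = a

      clip-Q : ∀ u q → clip u q ≡ b ⊎ clip u q ≡ a
      clip-Q u (yes q) = q
      clip-Q u (no _)  = inj₂ refl

      clip-≢ : ∀ u q → u ≢ clip u q → ¬ Q u
      clip-≢ u (yes _) ne = contradiction refl ne
      clip-≢ u (no ¬q) ne = ¬q

      -- It has at most two values and differs from `f` only where `f` leaves the pair, so the
      -- distance of `f` from NONMANIP bounds the frequency of all other outcomes from below.
      clipped : SCF n k
      clipped σ = clip (f σ) (Q? (f σ))

      outside : num * T ≤ den * Separate.#out Q?
      outside = ≤-trans (far clipped (inj₂ (b , a , λ σ → clip-Q (f σ) (Q? (f σ)))))
        (*-monoʳ-≤ den (∑-mono P λ σ →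
          indicator-mono (¬? (f σ F.≟ clipped σ)) (¬? (Q? (f σ))) (clip-≢ (f σ) (Q? (f σ)))))

      inside : T ≤ k * ∑[ σ ∈ P ] indicator (f σ F.≟ a) → T ≤ k * Separate.#in Q?
      inside a-popular = ≤-trans a-popular
        (*-monoʳ-≤ k (∑-mono P λ σ → indicator-mono (f σ F.≟ a) (Q? (f σ)) inj₂))

      apart : ∀ {u v} → ¬ Q u → Q v → u ≢ v
      apart ¬q q refl = ¬q q

      module _ {l₂ c d} (¬Qc : ¬ Q c) (Qd : Q d) (large₂ : Large l₂ c d) where

        -- The boundary of another voter replaces one of the two found. If it has an outcome outside
        -- the pair `a`, `b`, it replaces the second, with that outcome listed first. If both its
        -- outcomes belong to the pair, then `c` avoids them and it replaces the first.
        third : l₁ ≡ l₂ → (∃ λ l → ∃ λ u → ∃ λ v → (l ≢ l₁ × u ≢ v) × Large l u v) → TwoBoundaries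
        third refl (l₃ , u , v , (l₃≢l₁ , u≢v) , large₃) = cases (Q? u) (Q? v)
          where
          cases : Dec (Q u) → Dec (Q v) → TwoBoundaries
          cases (no ¬Qu) _        = boundaries (l₃≢l₁ ∘ sym) b≢a u≢v (¬Qu ∘ inj₁) (¬Qu ∘ inj₂) large₁ large₃
          cases (yes _)  (no ¬Qv) = boundaries (l₃≢l₁ ∘ sym) b≢a (u≢v ∘ sym) (¬Qv ∘ inj₁) (¬Qv ∘ inj₂) large₁ (large-swap large₃)
          cases (yes Qu) (yes Qv) = boundaries l₃≢l₁ u≢v (apart ¬Qc Qd) (apart ¬Qc Qu) (apart ¬Qc Qv) large₃ large₂

        second : Dec (l₁ ≡ l₂) → TwoBoundaries
        second (no l₁≢l₂) = boundaries l₁≢l₂ b≢a (apart ¬Qc Qd) (¬Qc ∘ inj₁) (¬Qc ∘ inj₂) large₁ large₂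
        second (yes eq)   = third eq (second-coordinate 0<k l₁)

      conclude : (∃ λ l → ∃ λ u → ∃ λ v → (¬ Q u × Q v) × Large l u v) → TwoBoundaries
      conclude (l₂ , c , d , (¬Qc , Qd) , large₂) = second ¬Qc Qd large₂ (l₁ F.≟ l₂)

  two-boundaries : 0 < k → TwoBoundaries
  two-boundaries 0<k = from-popular popular
    where
    from-popular : (∃ λ u → T ≤ k * ∑[ σ ∈ P ] indicator (f σ F.≟ u)) → TwoBoundaries
    from-popular (a , a-popular) = from-first (Separate.separate (F._≟ a)
      (far (λ _ → a) (inj₂ (a , a , λ _ → inj₁ refl))) a-popular)
      where
      from-first : (∃ λ l → ∃ λ u → ∃ λ v → (u ≢ a × v ≡ a) × Large l u v) → TwoBoundaries
      from-first (l₁ , b , .a , (b≢a , refl) , large₁) = conclude (Separate.separate Q? outside (inside a-popular))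
        where open Second b≢a 0<k large₁

-- The numerical bound and the final count

combine : ∀ {num den n k N T β β' m} → num ≤ den → 1 ≤ n → 1 ≤ N → 0 < T →
  num * T ≤ den * (n * (k * k * k)) * β → num * T ≤ den * (n * (k * k * k)) * β' →
  β * β * (β' * β') ≤ T * T * T * ((1 + 2 * n) * (N * (N * m))) →
  num ^ 5 * T ≤ den ^ 5 * (4 * n ^ 7 * k ^ 12 * N ^ 4) * m
combine {num} {den} {n} {k} {N} {T} {β} {β'} {m} num≤den 1≤n 1≤N 0<T large large' meet = begin
  num ^ 5 * T
    ≡⟨ collect num T ⟩
  num * (num * num * num * num * T)
    ≤⟨ *-mono-≤ num≤den (≤-trans fourth (*-monoʳ-≤ (L * L * L * L) (*-mono-≤ linear quadratic))) ⟩
  den * (L * L * L * L * (4 * (n * n * n) * (N * N * N * N * m)))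
    ≡⟨ expand den n k N m ⟩
  den ^ 5 * (4 * n ^ 7 * k ^ 12 * N ^ 4) * m ∎
  where
  open ≤-Reasoning
  L = den * (n * (k * k * k))
  E = (1 + 2 * n) * (N * (N * m))
  instance
    T³≢0 : NonZero (T * T * T)
    T³≢0 = m*n≢0 (T * T) T {{m*n≢0 T T {{>-nonZero 0<T}} {{>-nonZero 0<T}}}} {{>-nonZero 0<T}}
  -- Powers appear as the products they unfold to because solve-∀ does not interpret _^_.
  collect : ∀ x t → (x * (x * (x * (x * (x * 1))))) * t ≡ x * (x * x * x * x * t)
  collect = solve-∀
  expand : ∀ d n k N m →
    d * (d * (n * (k * k * k)) * (d * (n * (k * k * k))) * (d * (n * (k * k * k))) * (d * (n * (k * k * k)))
      * (4 * (n * n * n) * (N * N * N * N * m)))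
    ≡ (d * (d * (d * (d * (d * 1)))))
      * (4 * (n * (n * (n * (n * (n * (n * (n * 1)))))))
           * (k * (k * (k * (k * (k * (k * (k * (k * (k * (k * (k * (k * 1))))))))))))
           * (N * (N * (N * (N * 1))))) * m
  expand = solve-∀
  rearrange₁ : ∀ x t → t * t * t * (x * x * x * x * t) ≡ x * t * (x * t) * (x * t * (x * t))
  rearrange₁ = solve-∀
  rearrange₂ : ∀ l b b' → l * b * (l * b) * (l * b' * (l * b')) ≡ l * l * l * l * (b * b * (b' * b'))
  rearrange₂ = solve-∀
  rearrange₃ : ∀ l t e → l * l * l * l * (t * t * t * e) ≡ t * t * t * (l * l * l * l * e)
  rearrange₃ = solve-∀
  -- This is the sharper bound ε⁴ / ((1 + 2n) n⁴ k¹² (k!)²) on the frequency of manipulation points.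
  -- The stated form follows from ε ≤ 1, `linear` and `quadratic`.
  fourth : num * num * num * num * T ≤ L * L * L * L * E
  fourth = *-cancelˡ-≤ (T * T * T) (begin
    T * T * T * (num * num * num * num * T)          ≡⟨ rearrange₁ num T ⟩
    num * T * (num * T) * (num * T * (num * T))      ≤⟨ *-mono-≤ (*-mono-≤ large large) (*-mono-≤ large' large') ⟩
    L * β * (L * β) * (L * β' * (L * β'))            ≡⟨ rearrange₂ L β β' ⟩
    L * L * L * L * (β * β * (β' * β'))              ≤⟨ *-monoʳ-≤ (L * L * L * L) meet ⟩
    L * L * L * L * (T * T * T * E)                  ≡⟨ rearrange₃ L T E ⟩
    T * T * T * (L * L * L * L * E)                  ∎)
  linear : 1 + 2 * n ≤ 4 * (n * n * n)
  linear = begin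
    1 + 2 * n                ≤⟨ +-mono-≤ 1≤n (m≤m+n (2 * n) n) ⟩
    n + (2 * n + n)          ≡⟨ four n ⟩
    4 * n                    ≤⟨ *-monoʳ-≤ 4 (≤-trans (m≤m*n n n {{>-nonZero 1≤n}}) (m≤m*n (n * n) n {{>-nonZero 1≤n}})) ⟩
    4 * (n * n * n)          ∎
    where
    four : ∀ n → n + (2 * n + n) ≡ 4 * n
    four = solve-∀
  quadratic : N * (N * m) ≤ N * N * N * N * m
  quadratic = ≤-trans (≤-reflexive (sym (*-assoc N N m))) (*-monoˡ-≤ m
    (≤-trans (m≤m*n (N * N) N {{>-nonZero 1≤N}}) (m≤m*n (N * N * N) N {{>-nonZero 1≤N}})))

-- Translates a list of witnesses, the form of the hypothesis, into an exact count; `count-witness`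
-- goes back for the conclusion.
length-≤-count : ∀ {A : Set} {Q : A → Set} (Q? : ∀ x → Dec (Q x)) {xs ys : List A} →
  Unique xs → All Q xs → (∀ x → x ∈ ys) → length xs ≤ ∑[ y ∈ ys ] indicator (Q? y)
length-≤-count Q? u all complete =
  ≤-trans (count all) (∑-unique-≤ (indicator ∘ Q?) u (λ {x} _ → complete x))
  where
  count : ∀ {xs} → All _ xs → length xs ≤ ∑[ x ∈ xs ] indicator (Q? x)
  count []                   = z≤n
  count {xs = x ∷ _} (q ∷ qs) = +-mono-≤ (≤-reflexive (sym (indicator-yes (Q? x) q))) (count qs)

count-witness : ∀ {A : Set} {Q R : A → Set} (Q? : ∀ x → Dec (Q x)) {ys : List A} → Unique ys →
  (∀ {x} → Q x → R x) → ∀ {num} den → num ≤ den * ∑[ y ∈ ys ] indicator (Q? y) → CountAtLeast R num den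
count-witness Q? {ys} u imp {num} den le =
  filter Q? ys , Uniqueₚ.filter⁺ Q? u , All.map imp (all-filter Q? ys) ,
  subst (λ l → num ≤ den * l) (sym (length-filter Q? ys)) le

module _ {n k} (f : SCF n k) where
  open Social f

  manip-bound : ∀ a b → 1 ≤ n → 0 < k → 1 ≤ a →
    ((g : SCF n k) → NonManip g → CountAtLeast (λ σ → f σ ≢ g σ) (a * (k !) ^ n) b) →
    a ^ 5 * (k !) ^ n ≤ b ^ 5 * (4 * n ^ 7 * k ^ 12 * (k !) ^ 4) * #manip
  manip-bound a b 1≤n 0<k 1≤a hyp =
    subst (λ K → a ^ 5 * K ^ n ≤ b ^ 5 * (4 * n ^ 7 * k ^ 12 * K ^ 4) * #manip) (length-rankings k)
      (conclude (two-boundaries 0<k))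
    where
    0<N : 0 < N
    0<N = subst (0 <_) (sym (length-rankings k)) (>-nonZero⁻¹ (k !) {{k !≢0}})
    0<T : 0 < N ^ n
    0<T = m^n>0 N {{>-nonZero 0<N}} n
    far : ∀ g → NonManip g → a * N ^ n ≤ b * ∑[ σ ∈ P ] indicator (¬? (f σ F.≟ g σ))
    far g ng with hyp g ng
    ... | xs , u , all , le = ≤-trans (subst (λ K → a * K ^ n ≤ b * length xs) (sym (length-rankings k)) le)
      (*-monoʳ-≤ b (length-≤-count (λ σ → ¬? (f σ F.≟ g σ)) u all (∈-vecs ∈-rankings)))
    open Boundaries f a b 1≤a far 0<N using (TwoBoundaries; two-boundaries)
    -- A constant function belongs to NONMANIP, and no distance exceeds 1; hence ε ≤ 1.
    a≤b : a ≤ b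
    a≤b = *-cancelʳ-≤ a b (N ^ n) {{>-nonZero 0<T}} (≤-trans
      (far (λ _ → top) (inj₂ (top , top , λ _ → inj₁ refl)))
      (*-monoʳ-≤ b (≤-trans (∑-mono P λ σ → indicator-≤1 (¬? (f σ F.≟ top)))
        (≤-reflexive (trans (∑-const P 1) (trans (*-identityʳ _) (length-vecs S n)))))))
      where
      top : Fin k
      top = F.fromℕ< 0<k
    conclude : TwoBoundaries → a ^ 5 * N ^ n ≤ b ^ 5 * (4 * n ^ 7 * k ^ 12 * N ^ 4) * #manip
    conclude tb = combine {k = k} a≤b 1≤n 0<N 0<T large₁ large₂ (Meeting.meeting f i≢j a≢b c≢d c≢a c≢b 0<N)
      where open Boundaries.TwoBoundaries tb

  triples : List (Profile n k × Fin n × Ranking k)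
  triples = cartesianProductWith _,_ P (cartesianProductWith _,_ (allFin n) S)

  triples-unique : Unique triples
  triples-unique = Uniqueₚ.cartesianProduct⁺ (vecs-unique (rankings-unique k) n)
    (Uniqueₚ.cartesianProduct⁺ (Uniqueₚ.allFin⁺ n) (rankings-unique k))

  manipulation? : (t : Profile n k × Fin n × Ranking k) →
    Dec (Manipulation (proj₁ t) (proj₁ (proj₂ t)) (proj₂ (proj₂ t)))
  manipulation? (σ , i , τ) = ≫-dec _ (lookup σ i) _

  -- Every manipulation point admits at least one successful choice of voter and new vote. Among the
  -- n k! equally likely choices this costs just the factor by which the second bound is weaker than
  -- the first.
  #manip-≤-pairs : #manip ≤ ∑[ t ∈ triples ] indicator (manipulation? t)
  #manip-≤-pairs = ≤-trans
    (∑-mono P λ σ → ≤-trans (∃-indicator (allFin n) ∈-allFin (votes? σ) (manipulable? σ))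
      (∑-mono (allFin n) λ i → ∃-indicator S ∈-rankings (λ τ → manipulation? (σ , i , τ)) (votes? σ i)))
    (≤-reflexive (sym (trans (∑-product _,_ P _ _) (∑-cong P λ σ → ∑-product _,_ (allFin n) S _))))
    where
    votes? : ∀ σ i → Dec (∃ λ τ → Manipulation σ i τ)
    votes? σ i = ∃? ∈-rankings λ τ → manipulation? (σ , i , τ)

  manipulation⇒pair : ∀ {σ i τ} → Manipulation σ i τ → ManipPair f σ (σ [ i ]≔ τ)
  manipulation⇒pair {σ} {i} {τ} m = i , (λ j j≢i → sym (Vecₚ.lookup∘update′ j≢i σ τ)) , unwrap m

theorem3p1 : (n k a b : ℕ) → 2 ≤ n → 3 ≤ k → 1 ≤ a → 1 ≤ b →
    (f : SCF n k) →
    ((g : SCF n k) → NonManip g →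
    CountAtLeast (λ σ → f σ ≢ g σ) (a * (k !) ^ n) b) →
    CountAtLeast (ManipPoint f)
    (a ^ 5 * (k !) ^ n)
    (b ^ 5 * (4 * n ^ 7 * k ^ 12 * (k !) ^ 4))
    × CountAtLeast {Profile n k × Fin n × Ranking k}
    (λ { (σ , i , τ) → ManipPair f σ (σ [ i ]≔ τ) })
    (a ^ 5 * ((k !) ^ n * n * k !))
    (b ^ 5 * (4 * n ^ 8 * k ^ 12 * (k !) ^ 5))
theorem3p1 n k a b 2≤n 3≤k 1≤a 1≤b f hyp =
  count-witness manipulable? (vecs-unique (rankings-unique k) n)
    (λ { (i , τ , m) → _ , manipulation⇒pair f m })
    (b ^ 5 * (4 * n ^ 7 * k ^ 12 * (k !) ^ 4)) points ,
  count-witness (manipulation? f) (triples-unique f) (manipulation⇒pair f)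
    (b ^ 5 * (4 * n ^ 8 * k ^ 12 * (k !) ^ 5)) pairs
  where
  open Social f
  points : a ^ 5 * (k !) ^ n ≤ b ^ 5 * (4 * n ^ 7 * k ^ 12 * (k !) ^ 4) * #manip
  points = manip-bound f a b (≤-trans (s≤s z≤n) 2≤n) (≤-trans (s≤s z≤n) 3≤k) 1≤a hyp
  pairs : a ^ 5 * ((k !) ^ n * n * k !) ≤ b ^ 5 * (4 * n ^ 8 * k ^ 12 * (k !) ^ 5)
    * ∑[ t ∈ triples f ] indicator (manipulation? f t)
  pairs = begin
    a ^ 5 * ((k !) ^ n * n * k !)
      ≡⟨ rearrange₁ (a ^ 5) ((k !) ^ n) n (k !) ⟩
    n * k ! * (a ^ 5 * (k !) ^ n)
      ≤⟨ *-monoʳ-≤ (n * k !) (≤-trans points (*-monoʳ-≤ (b ^ 5 * (4 * n ^ 7 * k ^ 12 * (k !) ^ 4)) (#manip-≤-pairs f))) ⟩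
    n * k ! * (b ^ 5 * (4 * n ^ 7 * k ^ 12 * (k !) ^ 4) * ∑[ t ∈ triples f ] indicator (manipulation? f t))
      ≡⟨ rearrange₂ n (k !) (b ^ 5) (n ^ 7) (k ^ 12) ((k !) ^ 4) _ ⟩
    b ^ 5 * (4 * n ^ 8 * k ^ 12 * (k !) ^ 5) * ∑[ t ∈ triples f ] indicator (manipulation? f t) ∎
    where
    open ≤-Reasoning
    rearrange₁ : ∀ x t n K → x * (t * n * K) ≡ n * K * (x * t)
    rearrange₁ = solve-∀
    rearrange₂ : ∀ n K y u v w s → n * K * (y * (4 * u * v * w) * s) ≡ y * (4 * (n * u) * v * (K * w)) * s
    rearrange₂ = solve-∀
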